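{- Let $M$ be a loopless matroid on $E$, $m\geq1$, and $Q=Q_m(M)$. (1) If $m>1$, then the configuration of $Q\setminus a$ determines $M$ up to isomorphism. (2) If $m>1$, then $m$ together with the configuration of $Q\setminus E$ determines $M$ up to isomorphism. (3) If $m>2$, then $m$ together with the configuration of $Q\setminus(E\cup\{a\})$ determines $M$ up to isomorphism. (Here "determines" means: for loopless $M,N$ and the same $m$, equality of the respective configurations implies $M\cong N$.)
   Context: Cyclic set: $X$ with $M|X$ having no coloops; cyclic flat: a flat that is cyclic; $\mathcal{Z}(M)$: the lattice (under inclusion) of cyclic flats. The configuration of a matroid $M$ is the triple $(L,s,\rho)$ where $L$ is an abstract lattice with an isomorphism $\phi:L\to\mathcal{Z}(M)$, $s(x)=|\phi(x)|$ and $\rho(x)=r(\phi(x))$; two configurations are equal if there is a lattice isomorphism preserving $s$ and $\rho$. Free $m$-cone: let $M=(E,r)$ be loopless and $m\geq1$. For each $e\in E$ let $T_e$ be a set of $m$ new elements (pairwise disjoint, disjoint from $E$), $T=\bigcup_e T_e$, and $a$ a further new element (the tip); $E(Q)=E\cup T\cup\{a\}$. For $S\subseteq E$ let $q(S)=S\cup\{a\}\cup\bigcup_{e\in S}T_e$. The free $m$-cone $Q_m(M)$ is the unique matroid on $E(Q)$ whose cyclic flats are exactly the sets in $\mathcal{Z}(M)\cup\{q(F):F\text{ a nonempty flat of }M\}$, with rank $r(Z)$ on $Z\in\mathcal{Z}(M)$ and rank $r(F)+1$ on $q(F)$. -}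

module Defs where

open import Data.Nat using (ℕ; suc; _+_; _*_; _≤_; _<_)
open import Data.Fin using (Fin; splitAt; remQuot)
open import Data.Fin.Subset using (Subset; _∈_; _∉_; _⊆_; _∪_; _∩_; _-_; ⁅_⁆; ∣_∣; ⊤; Nonempty; inside; outside)
open import Data.Vec using (tabulate; lookup)
open import Data.Sum using (_⊎_; inj₁; inj₂)
open import Data.Product using (Σ; _×_; proj₁; _,_)
open import Function.Bundles using (_⇔_; _↔_; Inverse)
open import Relation.Binary.PropositionalEquality using (_≡_)

record Matroid (n : ℕ) : Set where
  field
    r       : Subset n → ℕ
    r-bound : ∀ X → r X ≤ ∣ X ∣
    r-mono  : ∀ {X Y} → X ⊆ Y → r X ≤ r Y
    r-sub   : ∀ X Y → r (X ∪ Y) + r (X ∩ Y) ≤ r X + r Y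

open Matroid public

Loopless : ∀ {n} → Matroid n → Set
Loopless {n} M = ∀ (e : Fin n) → 1 ≤ r M ⁅ e ⁆

-- Flats / cyclic sets / cyclic flats of the restriction M|S
-- (S a subset of the ground set; M|S has rank function r restricted to subsets of S).
IsFlatIn : ∀ {n} → Matroid n → Subset n → Subset n → Set
IsFlatIn M S X = X ⊆ S × (∀ e → e ∈ S → e ∉ X → r M X < r M (X ∪ ⁅ e ⁆))

-- cyclic: M|X has no coloops, i.e. r(X - e) = r(X) for all e ∈ X
IsCyclic : ∀ {n} → Matroid n → Subset n → Set
IsCyclic M X = ∀ e → e ∈ X → r M (X - e) ≡ r M X

IsCyclicFlatIn : ∀ {n} → Matroid n → Subset n → Subset n → Set
IsCyclicFlatIn M S X = IsFlatIn M S X × IsCyclic M X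

IsFlat : ∀ {n} → Matroid n → Subset n → Set
IsFlat M X = IsFlatIn M ⊤ X

IsCyclicFlat : ∀ {n} → Matroid n → Subset n → Set
IsCyclicFlat M X = IsCyclicFlatIn M ⊤ X

CF : ∀ {n} → Matroid n → Subset n → Set
CF M S = Σ (Subset _) (IsCyclicFlatIn M S)

-- Equality of configurations of M|S and N|T: a lattice isomorphism
-- (= order isomorphism w.r.t. inclusion) between the lattices of cyclic
-- flats, preserving size s and rank ρ.

record ConfigEq {n k : ℕ} (M : Matroid n) (S : Subset n)
                (N : Matroid k) (T : Subset k) : Set where
  field
    f        : CF M S → CF N T
    g        : CF N T → CF M S
    g∘f      : ∀ Z → proj₁ (g (f Z)) ≡ proj₁ Z
    f∘g      : ∀ W → proj₁ (f (g W)) ≡ proj₁ W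
    order    : ∀ Z Z′ → (proj₁ Z ⊆ proj₁ Z′) ⇔ (proj₁ (f Z) ⊆ proj₁ (f Z′))
    size     : ∀ Z → ∣ proj₁ (f Z) ∣ ≡ ∣ proj₁ Z ∣
    rank     : ∀ Z → r N (proj₁ (f Z)) ≡ r M (proj₁ Z)

record Iso {n k : ℕ} (M : Matroid n) (N : Matroid k) : Set where
  field
    σ        : Fin n ↔ Fin k
    preserve : ∀ (X : Subset n) →
               r N (tabulate (λ j → lookup X (Inverse.from σ j))) ≡ r M X

-- Ground set of the free m-cone: E ∪ T ∪ {a} encoded as Fin (n + (n*m + 1)).
-- E = first n elements; T_e = {(e,i) : i < m} encoded via remQuot; a = last.

data QElem (n m : ℕ) : Set where
  eE : Fin n → QElem n m
  eT : Fin n → Fin m → QElem n m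
  eA : QElem n m

qsize : ℕ → ℕ → ℕ
qsize n m = n + (n * m + 1)

decode : ∀ {n m} → Fin (qsize n m) → QElem n m
decode {n} {m} j with splitAt n j
... | inj₁ e = eE e
... | inj₂ t with splitAt (n * m) t
...   | inj₁ u with remQuot {n} m u
...     | (e , i) = eT e i
decode {n} {m} j | inj₂ t | inj₂ _ = eA

embedE : ∀ {n m} → Subset n → Subset (qsize n m)
embedE {n} {m} S = tabulate λ j → h (decode {n} {m} j)
  where
  h : QElem n m → _
  h (eE e)   = lookup S e
  h (eT _ _) = outside
  h eA       = outside

qOf : ∀ {n m} → Subset n → Subset (qsize n m)
qOf {n} {m} S = tabulate λ j → h (decode {n} {m} j)
  where
  h : QElem n m → _
  h (eE e)   = lookup S e
  h (eT e _) = lookup S e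
  h eA       = inside

groundMinusA : ∀ n m → Subset (qsize n m)
groundMinusA n m = tabulate λ j → h (decode {n} {m} j)
  where
  h : QElem n m → _
  h (eE _)   = inside
  h (eT _ _) = inside
  h eA       = outside

groundMinusE : ∀ n m → Subset (qsize n m)
groundMinusE n m = tabulate λ j → h (decode {n} {m} j)
  where
  h : QElem n m → _
  h (eE _)   = outside
  h (eT _ _) = inside
  h eA       = inside

groundT : ∀ n m → Subset (qsize n m)
groundT n m = tabulate λ j → h (decode {n} {m} j)
  where
  h : QElem n m → _
  h (eE _)   = outside
  h (eT _ _) = inside
  h eA       = outside

-- Q is the free m-cone Q_m(M): its cyclic flats are exactly the sets of
-- Z(M) ∪ {q(F) : F a nonempty flat of M}, with the prescribed ranks.
-- (A matroid is determined by its cyclic flats and their ranks, so this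
-- pins Q down uniquely.)

record IsFreeCone {n : ℕ} (M : Matroid n) (m : ℕ) (Q : Matroid (qsize n m)) : Set where
  field
    cyclicFlats : ∀ (Z : Subset (qsize n m)) →
      IsCyclicFlat Q Z ⇔
        ((Σ (Subset n) λ Z′ → IsCyclicFlat M Z′ × Z ≡ embedE Z′)
         ⊎ (Σ (Subset n) λ F → IsFlat M F × Nonempty F × Z ≡ qOf F))
    rankZ : ∀ Z′ → IsCyclicFlat M Z′ → r Q (embedE Z′) ≡ r M Z′
    rankq : ∀ F → IsFlat M F → Nonempty F → r Q (qOf F) ≡ suc (r M F)

{-# OPTIONS --safe #-}
module Submission where

-- Each cyclic flat X of a restriction Q|S is the trace on S of the cyclic flat cl(X) of Q, and
-- conversely the traces of the sets q(F) stay cyclic because q(F) minus two elements still has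
-- rank r(F) + 1.  Hence in (2) and (3) the configuration is the lattice of flats of M with known
-- sizes, from which a loopless matroid is rebuilt by matching its rank-1 flats elementwise.
--
-- In (1) the cyclic flats of M are present as well and must be told apart from the q(F) \ a.  For
-- r(F) ≥ 2, comparing the sizes of the flats covering a corank-1 flat of F shows that an isomorphism
-- of configurations cannot match q(F) \ a with a cyclic flat of M.  For r(F) = 1 this may happen,
-- but then a cyclic line of M on F is matched with some q(P′) \ a, and F ↦ P′ repairs the matching.

open import Defs
open import Data.Bool using (Bool; true; false; _∧_)
open import Data.Empty using (⊥-elim) renaming (⊥ to Absurd)
open import Data.Fin using (Fin; zero; suc; _↑ˡ_; _↑ʳ_; combine; splitAt; punchIn)
open import Data.Fin.Patterns using (0F; 1F)
open import Data.Fin.Permutation using (Permutation; _⟨$⟩ʳ_; _⟨$⟩ˡ_; insert; inverseʳ; inverseˡ; insert-punchIn) renaming (id to idᵖ)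
open import Data.Fin.Properties using (any?; punchInᵢ≢i; punchIn-injective; splitAt-↑ˡ; splitAt-↑ʳ; remQuot-combine; splitAt⁻¹-↑ˡ; splitAt⁻¹-↑ʳ; combine-surjective) renaming (_≟_ to _≟ᶠ_; suc-injective to sucᶠ-injective; 0≢1+n to 0≢1+nᶠ)
open import Data.Fin.Subset using (Subset; _∈_; _∉_; _⊆_; _∪_; _∩_; _-_; _─_; ⁅_⁆; ∣_∣; ⊤; ⊥; Nonempty; Empty; inside; outside)
open import Data.Fin.Subset.Properties
open import Data.List using (List; []; _∷_; allFin)
open import Data.List.Membership.Propositional.Properties using (∈-allFin)
import Data.List.Membership.Propositional as List
open import Data.List.Relation.Unary.Any using (here; there)
open import Data.Maybe using (Maybe; just; nothing)
open import Data.Maybe.Properties using (just-injective)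
open import Data.Nat using (ℕ; zero; suc; _+_; _*_; _≤_; _<_; z≤n; s≤s; s≤s⁻¹; >-nonZero)
open import Data.Nat.Properties
open import Data.Product using (Σ; ∃; _×_; _,_; proj₁; proj₂)
open import Data.Sum using (_⊎_; inj₁; inj₂; [_,_]′)
open import Data.Vec using ([]; _∷_; tabulate; lookup; here; there)
open import Data.Vec.Properties using (lookup∘tabulate; lookup⇒[]=; []=⇒lookup; lookup-zipWith; ≡-dec; tabulate∘lookup; tabulate-cong)
open import Function using (_∘_)
open import Function.Bundles using (Equivalence; Inverse)
open import Relation.Binary.PropositionalEquality using (_≡_; _≢_; refl; sym; trans; cong; cong₂; subst; subst₂; module ≡-Reasoning)
open import Relation.Nullary using (¬_; Dec; yes; no; does; contradiction)
open import Relation.Nullary.Decidable using (dec-true; _×-dec_)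
import Data.Bool.Properties as Bool

-- The exchange of a cyclic line with a cone over a point really occurs. Let `M` be the uniform
-- matroid of rank 2 on `m + 1` elements, with `m > 1`. Its ground set and the sets q({e}) without
-- the tip all have size `m + 1` and rank 2, are pairwise incomparable, and have the same cyclic
-- flats above and below them, so every permutation of them is an automorphism of the configuration.
-- Hence relating F to F′ exactly when their cones are matched need not give a total relation. The
-- comparison of covers cannot reach rank 1: the flat of corank 1 in a point of a loopless matroid
-- is empty, and there is no cone over the empty flat.

private variable
  n k : ℕ

-- Finite subsets

_≟ˢ_ : (X Y : Subset n) → Dec (X ≡ Y)
_≟ˢ_ = ≡-dec Bool._≟_

∪-least : ∀ {X Y Z : Subset n} → X ⊆ Z → Y ⊆ Z → X ∪ Y ⊆ Z
∪-least {X = X} {Y} f g = [ f , g ]′ ∘ x∈p∪q⁻ X Y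

∪-monoˡ : ∀ {X Y : Subset n} Z → X ⊆ Y → X ∪ Z ⊆ Y ∪ Z
∪-monoˡ Z f = ∪-least (p⊆p∪q Z ∘ f) (q⊆p∪q _ Z)

⁅⁆⊆ : ∀ {e} {X : Subset n} → e ∈ X → ⁅ e ⁆ ⊆ X
⁅⁆⊆ {e = e} {X} e∈X x∈ = subst (_∈ X) (sym (x∈⁅y⁆⇒x≡y e x∈)) e∈X

∈─⇒∉ : ∀ {x} (X Y : Subset n) → x ∈ X ─ Y → x ∉ Y
∈─⇒∉ (_ ∷ X) (outside ∷ Y) here       ()
∈─⇒∉ (_ ∷ X) (s ∷ Y)       (there x∈) (there x∈Y) = ∈─⇒∉ X Y x∈ x∈Y

∈-⇒≢ : ∀ {x} (X : Subset n) y → x ∈ X - y → x ≢ y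
∈-⇒≢ X y x∈ refl = ∈─⇒∉ X ⁅ y ⁆ x∈ (x∈⁅x⁆ y)

⊆-∪ : ∀ (X : Subset n) Y → X ⊆ Y ∪ (X ─ Y)
⊆-∪ X Y {x} x∈X with x ∈? Y
... | yes x∈Y = p⊆p∪q _ x∈Y
... | no  x∉Y = q⊆p∪q Y _ (x∈p∧x∉q⇒x∈p─q x∈X x∉Y)

⊆-remove-∪ : ∀ (X : Subset n) e → X ⊆ (X - e) ∪ ⁅ e ⁆
⊆-remove-∪ X e {x} x∈X with x ≟ᶠ e
... | yes refl = q⊆p∪q (X - e) _ (x∈⁅x⁆ e)
... | no  x≢e  = p⊆p∪q _ (x∈p∧x≢y⇒x∈p-y x∈X x≢e)

∣∪∣+∣∩∣ : ∀ (X Y : Subset n) → ∣ X ∪ Y ∣ + ∣ X ∩ Y ∣ ≡ ∣ X ∣ + ∣ Y ∣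
∣∪∣+∣∩∣ []            []            = refl
∣∪∣+∣∩∣ (outside ∷ X) (outside ∷ Y) = ∣∪∣+∣∩∣ X Y
∣∪∣+∣∩∣ (inside  ∷ X) (outside ∷ Y) = cong suc (∣∪∣+∣∩∣ X Y)
∣∪∣+∣∩∣ (outside ∷ X) (inside  ∷ Y) = trans (cong suc (∣∪∣+∣∩∣ X Y)) (sym (+-suc ∣ X ∣ ∣ Y ∣))
∣∪∣+∣∩∣ (inside  ∷ X) (inside  ∷ Y) = cong suc (begin
  ∣ X ∪ Y ∣ + suc ∣ X ∩ Y ∣   ≡⟨ +-suc _ _ ⟩
  suc (∣ X ∪ Y ∣ + ∣ X ∩ Y ∣) ≡⟨ cong suc (∣∪∣+∣∩∣ X Y) ⟩
  suc (∣ X ∣ + ∣ Y ∣)         ≡⟨ +-suc _ _ ⟨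
  ∣ X ∣ + suc ∣ Y ∣           ∎)
  where open ≡-Reasoning

∣∪∣≤ : ∀ (X Y : Subset n) → ∣ X ∪ Y ∣ ≤ ∣ X ∣ + ∣ Y ∣
∣∪∣≤ X Y = ≤-trans (m≤m+n _ _) (≤-reflexive (∣∪∣+∣∩∣ X Y))

∣∣≤suc∣-∣ : ∀ (X : Subset n) e → ∣ X ∣ ≤ suc ∣ X - e ∣
∣∣≤suc∣-∣ X e = begin
  ∣ X ∣                     ≤⟨ p⊆q⇒∣p∣≤∣q∣ (⊆-remove-∪ X e) ⟩
  ∣ (X - e) ∪ ⁅ e ⁆ ∣       ≤⟨ ∣∪∣≤ (X - e) ⁅ e ⁆ ⟩
  ∣ X - e ∣ + ∣ ⁅ e ⁆ ∣     ≡⟨ cong (∣ X - e ∣ +_) (∣⁅x⁆∣≡1 e) ⟩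
  ∣ X - e ∣ + 1             ≡⟨ +-comm _ 1 ⟩
  suc ∣ X - e ∣             ∎
  where open ≤-Reasoning

∣⊇∣≤⇒⊆ : ∀ {X Y : Subset n} → X ⊆ Y → ∣ Y ∣ ≤ ∣ X ∣ → Y ⊆ X
∣⊇∣≤⇒⊆ {X = X} X⊆Y ≤X {x} x∈Y with x ∈? X
... | yes x∈X = x∈X
... | no  x∉X = contradiction (p⊂q⇒∣p∣<∣q∣ (X⊆Y , x , x∈Y , x∉X)) (≤⇒≯ ≤X)

Nonempty⇒0< : ∀ {X : Subset n} → Nonempty X → 0 < ∣ X ∣
Nonempty⇒0< {X = X} (e , e∈X) = subst (_≤ ∣ X ∣) (∣⁅x⁆∣≡1 e) (p⊆q⇒∣p∣≤∣q∣ (⁅⁆⊆ e∈X))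

0<⇒Nonempty : ∀ {X : Subset n} → 0 < ∣ X ∣ → Nonempty X
0<⇒Nonempty {n} {X} 0<X with nonempty? X
... | yes ne = ne
... | no ¬ne = contradiction (subst (λ Y → 0 < ∣ Y ∣) (Empty-unique ¬ne) 0<X) (<-irrefl (sym (∣⊥∣≡0 n)))

∣Empty∣ : ∀ {X : Subset n} → Empty X → ∣ X ∣ ≡ 0
∣Empty∣ {n} eX = trans (cong ∣_∣ (Empty-unique eX)) (∣⊥∣≡0 n)

injection⇒∣∣≤ : ∀ (h : Fin n → Fin k) (A : Subset n) (B : Subset k) → (∀ {e} → e ∈ A → h e ∈ B) →
                (∀ {e e′} → e ∈ A → e′ ∈ A → h e ≡ h e′ → e ≡ e′) → ∣ A ∣ ≤ ∣ B ∣
injection⇒∣∣≤ h []            B into inj = z≤n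
injection⇒∣∣≤ h (outside ∷ A) B into inj =
  injection⇒∣∣≤ (h ∘ suc) A B (into ∘ there) λ p q eq → sucᶠ-injective (inj (there p) (there q) eq)
injection⇒∣∣≤ h (inside ∷ A) B into inj = ≤-trans
  (s≤s (injection⇒∣∣≤ (h ∘ suc) A (B - h zero)
    (λ e∈A → x∈p∧x≢y⇒x∈p-y (into (there e∈A)) (λ eq → 0≢1+nᶠ (sym (inj (there e∈A) here eq))))
    (λ p q eq → sucᶠ-injective (inj (there p) (there q) eq))))
  (x∈p⇒∣p-x∣<∣p∣ (into here))

comprehension : ∀ {P : Fin n → Set} (P? : ∀ e → Dec (P e)) → Subset n
comprehension P? = tabulate (λ e → does (P? e))

module _ {P : Fin n → Set} (P? : ∀ e → Dec (P e)) where
  ∈-comprehension⁺ : ∀ {e} → P e → e ∈ comprehension P?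
  ∈-comprehension⁺ {e} pe =
    lookup⇒[]= e _ (trans (lookup∘tabulate _ e) (dec-true (P? e) pe))

  ∈-comprehension⁻ : ∀ {e} → e ∈ comprehension P? → P e
  ∈-comprehension⁻ {e} e∈ with P? e in eq
  ... | yes pe = pe
  ... | no ¬pe = contradiction
    (trans (sym ([]=⇒lookup e∈)) (trans (lookup∘tabulate _ e) (cong does eq))) λ ()

-- Closure, flats and cyclic flats

module _ (M : Matroid n) where

  r-⊥ : ∀ {X} → Empty X → r M X ≡ 0
  r-⊥ {X} ¬ne = n≤0⇒n≡0 (≤-trans (r-bound M X) (≤-reflexive (∣Empty∣ ¬ne)))

  r>0⇒Nonempty : ∀ {X} → 0 < r M X → Nonempty X
  r>0⇒Nonempty {X} 0<r = 0<⇒Nonempty (≤-trans 0<r (r-bound M X))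

  r-∪ : ∀ X Y → r M (X ∪ Y) ≤ r M X + r M Y
  r-∪ X Y = ≤-trans (m≤m+n _ _) (r-sub M X Y)

  r-─ : ∀ X Z → r M X ≤ r M Z + ∣ X ─ Z ∣
  r-─ X Z = ≤-trans (r-mono M (⊆-∪ X Z)) (≤-trans (r-∪ Z (X ─ Z)) (+-monoʳ-≤ (r M Z) (r-bound M (X ─ Z))))

  r-∪⁅⁆ : ∀ X e → r M (X ∪ ⁅ e ⁆) ≤ suc (r M X)
  r-∪⁅⁆ X e = begin
    r M (X ∪ ⁅ e ⁆)        ≤⟨ r-∪ X ⁅ e ⁆ ⟩
    r M X + r M ⁅ e ⁆      ≤⟨ +-monoʳ-≤ (r M X) (r-bound M ⁅ e ⁆) ⟩
    r M X + ∣ ⁅ e ⁆ ∣      ≡⟨ cong (r M X +_) (∣⁅x⁆∣≡1 e) ⟩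
    r M X + 1              ≡⟨ +-comm _ 1 ⟩
    suc (r M X)            ∎
    where open ≤-Reasoning

  r-remove : ∀ X e → r M X ≤ suc (r M (X - e))
  r-remove X e = ≤-trans (r-mono M (⊆-remove-∪ X e)) (r-∪⁅⁆ (X - e) e)

  private
    extend : Subset n → Subset n → List (Fin n) → Subset n
    extend X Y []      = X
    extend X Y (e ∷ l) with e ∈? Y
    ... | yes _ = extend X Y l ∪ ⁅ e ⁆
    ... | no  _ = extend X Y l

    ⊆-extend : ∀ X Y l → X ⊆ extend X Y l
    ⊆-extend X Y []      = λ x∈ → x∈
    ⊆-extend X Y (e ∷ l) with e ∈? Y
    ... | yes _ = p⊆p∪q _ ∘ ⊆-extend X Y l
    ... | no  _ = ⊆-extend X Y l

    ∈-extend : ∀ X Y l {e} → e List.∈ l → e ∈ Y → e ∈ extend X Y l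
    ∈-extend X Y (e ∷ l) (here refl) e∈Y with e ∈? Y
    ... | yes _  = q⊆p∪q (extend X Y l) _ (x∈⁅x⁆ e)
    ... | no e∉Y = contradiction e∈Y e∉Y
    ∈-extend X Y (d ∷ l) (there e∈l) e∈Y with d ∈? Y
    ... | yes _ = p⊆p∪q _ (∈-extend X Y l e∈l e∈Y)
    ... | no  _ = ∈-extend X Y l e∈l e∈Y

    -- Submodularity for `A` and `X ∪ ⁅ e ⁆`, whose intersection contains `X`, bounds the gain of
    -- `e` over `A` by its gain over `X`, which is zero.
    r-extend : ∀ X Y → (∀ {e} → e ∈ Y → r M (X ∪ ⁅ e ⁆) ≤ r M X) → ∀ l → r M (extend X Y l) ≤ r M X
    r-extend X Y noGain []      = ≤-refl
    r-extend X Y noGain (e ∷ l) with e ∈? Y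
    ... | no  _   = r-extend X Y noGain l
    ... | yes e∈Y = +-cancelʳ-≤ (r M X) _ _ (begin
      r M (A ∪ ⁅ e ⁆) + r M X
        ≤⟨ +-mono-≤ (r-mono M (∪-least (p⊆p∪q (X ∪ ⁅ e ⁆)) (q⊆p∪q A _ ∘ q⊆p∪q X _)))
                    (r-mono M (λ x∈ → x∈p∩q⁺ (⊆-extend X Y l x∈ , p⊆p∪q _ x∈))) ⟩
      r M (A ∪ (X ∪ ⁅ e ⁆)) + r M (A ∩ (X ∪ ⁅ e ⁆)) ≤⟨ r-sub M A (X ∪ ⁅ e ⁆) ⟩
      r M A + r M (X ∪ ⁅ e ⁆)                       ≤⟨ +-mono-≤ (r-extend X Y noGain l) (noGain e∈Y) ⟩
      r M X + r M X                                 ∎)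
      where
      open ≤-Reasoning
      A = extend X Y l

  r-noGain : ∀ X Y → (∀ {e} → e ∈ Y → r M (X ∪ ⁅ e ⁆) ≤ r M X) → r M Y ≤ r M X
  r-noGain X Y noGain = ≤-trans
    (r-mono M (λ {e} → ∈-extend X Y (allFin n) (∈-allFin e)))
    (r-extend X Y noGain (allFin n))

  private
    spanned? : ∀ X e → Dec (r M (X ∪ ⁅ e ⁆) ≤ r M X)
    spanned? X e = r M (X ∪ ⁅ e ⁆) ≤? r M X

  cl : Subset n → Subset n
  cl X = comprehension (spanned? X)

  ⊆cl : ∀ X → X ⊆ cl X
  ⊆cl X e∈X = ∈-comprehension⁺ (spanned? X) (r-mono M (∪-least (λ x∈ → x∈) (⁅⁆⊆ e∈X)))

  r-cl : ∀ X → r M (cl X) ≡ r M X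
  r-cl X = ≤-antisym (r-noGain X (cl X) (∈-comprehension⁻ (spanned? X))) (r-mono M (⊆cl X))

  cl-flat : ∀ X → IsFlat M (cl X)
  cl-flat X = ⊆-max _ , λ e _ e∉ → ≰⇒> λ ≤cl → e∉ (∈-comprehension⁺ (spanned? X)
    (≤-trans (r-mono M (∪-monoˡ ⁅ e ⁆ (⊆cl X))) (≤-trans ≤cl (≤-reflexive (r-cl X)))))

  -- By submodularity, `e` gains at least as much over `X` as over the larger set `F`.
  r<r∪⁅⁆ : ∀ {X F e} → IsFlat M F → X ⊆ F → e ∉ F → r M X < r M (X ∪ ⁅ e ⁆)
  r<r∪⁅⁆ {X} {F} {e} (_ , gain) X⊆F e∉F = +-cancelˡ-< (r M F) _ _ (begin-strict
    r M F + r M X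
      <⟨ +-monoˡ-< (r M X) (gain e ∈⊤ e∉F) ⟩
    r M (F ∪ ⁅ e ⁆) + r M X
      ≤⟨ +-mono-≤ (r-mono M (∪-least (p⊆p∪q _) (q⊆p∪q F _ ∘ q⊆p∪q X _)))
                  (r-mono M (λ x∈ → x∈p∩q⁺ (X⊆F x∈ , p⊆p∪q _ x∈))) ⟩
    r M (F ∪ (X ∪ ⁅ e ⁆)) + r M (F ∩ (X ∪ ⁅ e ⁆)) ≤⟨ r-sub M F (X ∪ ⁅ e ⁆) ⟩
    r M F + r M (X ∪ ⁅ e ⁆)                       ∎)
    where open ≤-Reasoning

  flat-absorbs : ∀ {F X Y} → IsFlat M F → X ⊆ F → X ⊆ Y → r M Y ≤ r M X → Y ⊆ F
  flat-absorbs {F} {X} {Y} flF X⊆F X⊆Y rY≤rX {e} e∈Y with e ∈? F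
  ... | yes e∈F = e∈F
  ... | no  e∉F = contradiction
    (≤-trans (r-mono M (∪-least X⊆Y (⁅⁆⊆ e∈Y))) rY≤rX) (<⇒≱ (r<r∪⁅⁆ flF X⊆F e∉F))

  cl-least : ∀ {X F} → IsFlat M F → X ⊆ F → cl X ⊆ F
  cl-least {X} flF X⊆F = flat-absorbs flF X⊆F (⊆cl X) (≤-reflexive (r-cl X))

  cl-⊆-flat : ∀ {e F} → IsFlat M F → e ∈ F → cl ⁅ e ⁆ ⊆ F
  cl-⊆-flat flF e∈F = cl-least flF (⁅⁆⊆ e∈F)

  ∈cl : ∀ e → e ∈ cl ⁅ e ⁆
  ∈cl e = ⊆cl ⁅ e ⁆ (x∈⁅x⁆ e)

  -- If `e` lies in `X`, then `X - e` already has full rank; otherwise all of `X` survives the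
  -- removal of `e`.
  cl-cyclic : ∀ {X} → IsCyclic M X → IsCyclic M (cl X)
  cl-cyclic {X} cyc e e∈ = ≤-antisym (r-mono M (p─q⊆p _ _)) (≤-trans (≤-reflexive (r-cl X)) go)
    where
    go : r M X ≤ r M (cl X - e)
    go with e ∈? X
    ... | yes e∈X = ≤-trans (≤-reflexive (sym (cyc e e∈X)))
      (r-mono M λ x∈ → x∈p∧x≢y⇒x∈p-y (⊆cl X (p─q⊆p X _ x∈)) (∈-⇒≢ X e x∈))
    ... | no  e∉X = r-mono M λ x∈ → x∈p∧x≢y⇒x∈p-y (⊆cl X x∈) (λ { refl → e∉X x∈ })

  cyclic⊎coloop : ∀ X → IsCyclic M X ⊎ ∃ λ e → e ∈ X × r M (X - e) < r M X
  cyclic⊎coloop X with any? (λ e → (e ∈? X) ×-dec (r M (X - e) <? r M X))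
  ... | yes c = inj₂ c
  ... | no ¬c = inj₁ λ e e∈X → ≤-antisym (r-mono M (p─q⊆p X _)) (≮⇒≥ λ lt → ¬c (e , e∈X , lt))

  -- Elements outside `X` still gain because `X` is a flat; the only new outside element is `e`,
  -- which gains because it is a coloop.
  remove-coloop-flat : ∀ {X e} → IsFlat M X → e ∈ X → r M (X - e) < r M X → IsFlat M (X - e)
  remove-coloop-flat {X} {e} flX e∈X lt = ⊆-max _ , gain
    where
    gain : ∀ d → d ∈ ⊤ → d ∉ X - e → r M (X - e) < r M ((X - e) ∪ ⁅ d ⁆)
    gain d _ d∉ with d ∈? X
    ... | no  d∉X = r<r∪⁅⁆ flX (p─q⊆p X _) d∉X
    ... | yes d∈X with d ≟ᶠ e
    ...   | yes refl = ≤-trans lt (r-mono M (⊆-remove-∪ X e))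
    ...   | no  d≢e  = contradiction (x∈p∧x≢y⇒x∈p-y d∈X d≢e) d∉

  private
    -- Each coloop removed lowers the rank, which pays for the element it adds to `X ─ Z`. The bound
    -- `s` on the size drives the recursion.
    cyclic-part : ∀ s {X} → ∣ X ∣ ≤ s → IsFlat M X →
                  ∃ λ Z → IsCyclicFlat M Z × r M Z + ∣ X ─ Z ∣ ≤ r M X
    cyclic-part s {X} ≤s flX with cyclic⊎coloop X
    cyclic-part s {X} ≤s flX | inj₁ cyc = X , (flX , cyc) , ≤-reflexive (begin
      r M X + ∣ X ─ X ∣ ≡⟨ cong (r M X +_) (∣Empty∣ λ (x , x∈) → ∈─⇒∉ X X x∈ (p─q⊆p X X x∈)) ⟩
      r M X + 0         ≡⟨ +-identityʳ _ ⟩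
      r M X             ∎)
      where open ≡-Reasoning
    cyclic-part zero    ≤s flX | inj₂ (e , e∈X , lt) = contradiction (Nonempty⇒0< (e , e∈X)) (≤⇒≯ ≤s)
    cyclic-part (suc s) {X} ≤s flX | inj₂ (e , e∈X , lt)
      with Z , cf , le ← cyclic-part s {X - e} (s≤s⁻¹ (≤-trans (x∈p⇒∣p-x∣<∣p∣ e∈X) ≤s)) (remove-coloop-flat flX e∈X lt)
      = Z , cf , (begin
      r M Z + ∣ X ─ Z ∣             ≤⟨ +-monoʳ-≤ (r M Z) (∣∣≤suc∣-∣ (X ─ Z) e) ⟩
      r M Z + suc ∣ X ─ Z - e ∣     ≡⟨ +-suc _ _ ⟩
      suc (r M Z + ∣ X ─ Z - e ∣)   ≡⟨ cong (λ Y → suc (r M Z + ∣ Y ∣)) (p─q─r≡p─r─q X Z ⁅ e ⁆) ⟩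
      suc (r M Z + ∣ X - e ─ Z ∣)   ≤⟨ s≤s le ⟩
      suc (r M (X - e))             ≤⟨ lt ⟩
      r M X                         ∎)
      where open ≤-Reasoning

  -- One half of r(X) = min {r(Z) + |X ─ Z| : Z a cyclic flat}: remove the coloops of cl X.
  rank-witness : ∀ X → ∃ λ Z → IsCyclicFlat M Z × r M Z + ∣ X ─ Z ∣ ≤ r M X
  rank-witness X with Z , cf , le ← cyclic-part _ ≤-refl (cl-flat X) = Z , cf , (begin
    r M Z + ∣ X ─ Z ∣    ≤⟨ +-monoʳ-≤ (r M Z) (p⊆q⇒∣p∣≤∣q∣ λ x∈ →
                              x∈p∧x∉q⇒x∈p─q (⊆cl X (p─q⊆p X Z x∈)) (∈─⇒∉ X Z x∈)) ⟩
    r M Z + ∣ cl X ─ Z ∣ ≤⟨ le ⟩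
    r M (cl X)           ≡⟨ r-cl X ⟩
    r M X                ∎)
    where open ≤-Reasoning

  private
    -- A discrete intermediate value argument: deleting one element lowers the rank by at most one.
    subset-of-rank : ∀ s {X} t → ∣ X ∣ ≤ s → t ≤ r M X → ∃ λ Y → Y ⊆ X × r M Y ≡ t
    subset-of-rank s {X} t ≤s t≤ with t ≟ r M X
    subset-of-rank s {X} t ≤s t≤ | yes eq = X , (λ x∈ → x∈) , sym eq
    subset-of-rank s {X} t ≤s t≤ | no t≢ with t<r ← ≤∧≢⇒< t≤ t≢ with r>0⇒Nonempty {X} (≤-trans (s≤s z≤n) t<r)
    subset-of-rank zero    t ≤s t≤ | no t≢ | ne = contradiction (Nonempty⇒0< ne) (≤⇒≯ ≤s)
    subset-of-rank (suc s) {X} t ≤s t≤ | no t≢ | e , e∈X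
      with Y , Y⊆ , eq ← subset-of-rank s {X - e} t (s≤s⁻¹ (≤-trans (x∈p⇒∣p-x∣<∣p∣ e∈X) ≤s))
                           (s≤s⁻¹ (≤-trans (≤∧≢⇒< t≤ t≢) (r-remove X e)))
      = Y , p─q⊆p X _ ∘ Y⊆ , eq

  subflat-of-rank : ∀ {F} t → IsFlat M F → t ≤ r M F → ∃ λ G → IsFlat M G × G ⊆ F × r M G ≡ t
  subflat-of-rank t flF t≤ with Y , Y⊆F , eq ← subset-of-rank _ t ≤-refl t≤ =
    cl Y , cl-flat Y , cl-least flF Y⊆F , trans (r-cl Y) eq

  module _ (loopless : Loopless M) where

    loopless⇒0<r : ∀ {X} → Nonempty X → 0 < r M X
    loopless⇒0<r (e , e∈X) = ≤-trans (loopless e) (r-mono M (⁅⁆⊆ e∈X))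

    ⊥-flat : IsFlat M ⊥
    ⊥-flat = ⊆-max _ , λ e _ _ → subst (_< r M (⊥ ∪ ⁅ e ⁆)) (sym (r-⊥ (∉⊥ ∘ proj₂)))
      (loopless⇒0<r (e , q⊆p∪q ⊥ _ (x∈⁅x⁆ e)))

-- Reconstruction of a loopless matroid from its lattice of flats

private
  ∣∷∣-cancel : ∀ b {X : Subset n} {Y : Subset k} → ∣ b ∷ X ∣ ≡ ∣ b ∷ Y ∣ → ∣ X ∣ ≡ ∣ Y ∣
  ∣∷∣-cancel inside  eq = suc-injective eq
  ∣∷∣-cancel outside eq = eq

  ∣tabulate∣-punchIn : ∀ (f : Fin (suc n) → Bool) j → ∣ tabulate f ∣ ≡ ∣ f j ∷ tabulate (f ∘ punchIn j) ∣
  ∣tabulate∣-punchIn         f zero    = refl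
  ∣tabulate∣-punchIn {suc n} f (suc j) with f zero | f (suc j) | ∣tabulate∣-punchIn (f ∘ suc) j
  ... | inside  | inside  | eq = cong suc eq
  ... | inside  | outside | eq = cong suc eq
  ... | outside | inside  | eq = eq
  ... | outside | outside | eq = eq

module _ {A : Set} (_≟_ : (a b : A) → Dec (a ≡ b)) where

  fibre : (Fin n → A) → A → Subset n
  fibre c a = comprehension (λ i → c i ≟ a)

  -- Induction on the domain: `zero` is paired with some `j` of the same colour, which exists
  -- because that fibre of `d` is as large as the one of `c`. Removing both keeps all fibre sizes
  -- equal.
  equal-fibres⇒permutation : (c : Fin n → A) (d : Fin k → A) → (∀ a → ∣ fibre c a ∣ ≡ ∣ fibre d a ∣) →
                             ∃ λ (π : Permutation n k) → ∀ i → d (π ⟨$⟩ʳ i) ≡ c i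
  equal-fibres⇒permutation {zero}  {zero}  c d eq = idᵖ , λ ()
  equal-fibres⇒permutation {zero}  {suc k} c d eq =
    contradiction (eq (d zero)) (<⇒≢ (Nonempty⇒0< (zero , ∈-comprehension⁺ (λ i → d i ≟ d zero) {zero} refl)))
  equal-fibres⇒permutation {suc n} {k} c d eq
    with 0<⇒Nonempty {X = fibre d (c zero)} (subst (0 <_) (eq (c zero)) (Nonempty⇒0< (zero , ∈-comprehension⁺ (λ i → c i ≟ c zero) {zero} refl)))
  equal-fibres⇒permutation {suc n} {zero}  c d eq | () , _
  equal-fibres⇒permutation {suc n} {suc k} c d eq | j , j∈ = insert zero j (proj₁ rest) , commutes
    where
    dj≡c0 : d j ≡ c zero
    dj≡c0 = ∈-comprehension⁻ (λ i → d i ≟ c zero) j∈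

    rest : ∃ λ (π : Permutation n k) → ∀ i → d (punchIn j (π ⟨$⟩ʳ i)) ≡ c (suc i)
    rest = equal-fibres⇒permutation (c ∘ suc) (d ∘ punchIn j) λ a →
      ∣∷∣-cancel (does (c zero ≟ a)) {fibre (c ∘ suc) a} {fibre (d ∘ punchIn j) a} (begin
        ∣ fibre c a ∣                                          ≡⟨ eq a ⟩
        ∣ fibre d a ∣                                          ≡⟨ ∣tabulate∣-punchIn (λ i → does (d i ≟ a)) j ⟩
        ∣ does (d j ≟ a) ∷ fibre (d ∘ punchIn j) a ∣           ≡⟨ cong (λ b → ∣ does (b ≟ a) ∷ fibre (d ∘ punchIn j) a ∣) dj≡c0 ⟩
        ∣ does (c zero ≟ a) ∷ fibre (d ∘ punchIn j) a ∣        ∎)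
      where open ≡-Reasoning

    commutes : ∀ i → d (insert zero j (proj₁ rest) ⟨$⟩ʳ i) ≡ c i
    commutes zero    = dj≡c0
    commutes (suc i) = trans (cong d (insert-punchIn zero j (proj₁ rest) i)) (proj₂ rest i)

-- Correspondences of posets with size and rank

record SizedPoset : Set₁ where
  field
    Carrier : Set
    _⊑_     : Carrier → Carrier → Set
    size    : Carrier → ℕ
    rank    : Carrier → ℕ

open SizedPoset

-- A relation instead of a pair of inverse maps: elements carry proofs of flatness, which may differ
-- over the same set. `mono` and `reflect` make partners unique up to mutual `⊑`, and `flip` halves
-- the symmetric arguments.
record Correspondence (A B : SizedPoset) : Set₁ where
  field
    _~_     : Carrier A → Carrier B → Set
    total   : ∀ a → ∃ λ b → a ~ b
    cototal : ∀ b → ∃ λ a → a ~ b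
    mono    : ∀ {a b a′ b′} → a ~ b → a′ ~ b′ → _⊑_ A a a′ → _⊑_ B b b′
    reflect : ∀ {a b a′ b′} → a ~ b → a′ ~ b′ → _⊑_ B b b′ → _⊑_ A a a′
    ~-size  : ∀ {a b} → a ~ b → size A a ≡ size B b
    ~-rank  : ∀ {a b} → a ~ b → rank A a ≡ rank B b

flip : ∀ {A B} → Correspondence A B → Correspondence B A
flip C = record
  { _~_     = λ b a → a ~ b
  ; total   = cototal
  ; cototal = total
  ; mono    = reflect
  ; reflect = mono
  ; ~-size  = sym ∘ ~-size
  ; ~-rank  = sym ∘ ~-rank
  }
  where open Correspondence C

Flats : Matroid n → SizedPoset
Flats M = record
  { Carrier = Σ (Subset _) (IsFlat M)
  ; _⊑_     = λ F G → proj₁ F ⊆ proj₁ G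
  ; size    = λ F → ∣ proj₁ F ∣
  ; rank    = λ F → r M (proj₁ F)
  }

span : (M : Matroid n) → Subset n → Carrier (Flats M)
span M X = cl M X , cl-flat M X

module _ (M : Matroid n) (loopless : Loopless M) where

  r-point : ∀ e → r M (cl M ⁅ e ⁆) ≡ 1
  r-point e = trans (r-cl M ⁅ e ⁆)
    (≤-antisym (≤-trans (r-bound M ⁅ e ⁆) (≤-reflexive (∣⁅x⁆∣≡1 e))) (loopless e))

  point-of : ∀ {F e} → IsFlat M F → r M F ≡ 1 → e ∈ F → F ≡ cl M ⁅ e ⁆
  point-of {F} {e} flF rF≡1 e∈F = ⊆-antisym
    (flat-absorbs M (cl-flat M ⁅ e ⁆) (λ x∈ → x∈) (cl-⊆-flat M flF e∈F)
                  (≤-reflexive (trans rF≡1 (sym (r-point e)))))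
    (cl-⊆-flat M flF e∈F)

-- Points (rank-1 flats) of equal size are matched elementwise; an element lies in a flat
-- exactly when the point it spans does, so the resulting bijection carries flats to flats.
module _ {M : Matroid n} {N : Matroid k} (llM : Loopless M) (llN : Loopless N)
         (C : Correspondence (Flats M) (Flats N)) where

  open Correspondence C

  private
    -- Elements of both matroids are coloured by points of `N`: an element of `M` by the partner of
    -- the point it spans, an element of `N` by the point it spans itself.
    point : Fin n → Carrier (Flats N)
    point i = proj₁ (total (span M ⁅ i ⁆))

    ~point : ∀ i → span M ⁅ i ⁆ ~ point i
    ~point i = proj₂ (total (span M ⁅ i ⁆))

    c≟ : ∀ a i → Dec (proj₁ (point i) ≡ a)
    c≟ a i = proj₁ (point i) ≟ˢ a

    d≟ : ∀ a j → Dec (cl N ⁅ j ⁆ ≡ a)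
    d≟ a j = cl N ⁅ j ⁆ ≟ˢ a

    fibre-M : ∀ {F a} → r M (proj₁ F) ≡ 1 → F ~ a → comprehension (c≟ (proj₁ a)) ≡ proj₁ F
    fibre-M {F , flF} {a , _} rF≡1 F~a = ⊆-antisym
      (λ {i} i∈ → reflect (~point i) F~a (⊆-reflexive (∈-comprehension⁻ (c≟ a) i∈)) (∈cl M i))
      (λ {i} i∈F → ∈-comprehension⁺ (c≟ a) (⊆-antisym
        (mono (~point i) F~a (cl-⊆-flat M flF i∈F))
        (mono F~a (~point i) (⊆-reflexive (point-of M llM flF rF≡1 i∈F)))))

    fibre-N : ∀ {a} → IsFlat N a → r N a ≡ 1 → comprehension (d≟ a) ≡ a
    fibre-N {a} fla ra≡1 = ⊆-antisym
      (λ {j} j∈ → ⊆-reflexive (∈-comprehension⁻ (d≟ a) j∈) (∈cl N j))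
      (λ {j} j∈a → ∈-comprehension⁺ (d≟ a) (sym (point-of N llN fla ra≡1 j∈a)))

    fibres-at-point : ∀ {F a} → r M (proj₁ F) ≡ 1 → F ~ a →
                      ∣ comprehension (c≟ (proj₁ a)) ∣ ≡ ∣ comprehension (d≟ (proj₁ a)) ∣
    fibres-at-point {a = _ , fla} rF≡1 F~a = trans (cong ∣_∣ (fibre-M rF≡1 F~a))
      (trans (~-size F~a) (cong ∣_∣ (sym (fibre-N fla (trans (sym (~-rank F~a)) rF≡1)))))

    -- A colour occurring on either side is a point of `N` with a partner in `M`, and its two fibres
    -- are these two points. Any other set has empty fibres.
    equal-fibres : ∀ a → ∣ comprehension (c≟ a) ∣ ≡ ∣ comprehension (d≟ a) ∣
    equal-fibres a with any? (c≟ a) | any? (d≟ a)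
    ... | yes (i , refl) | _ = fibres-at-point (r-point M llM i) (~point i)
    ... | no _ | yes (j , refl) with F , F~a ← cototal (span N ⁅ j ⁆) =
      fibres-at-point (trans (~-rank F~a) (r-point N llN j)) F~a
    ... | no ¬c | no ¬d = trans (empty (c≟ a) ¬c) (sym (empty (d≟ a) ¬d))
      where
      empty : ∀ {l} {P : Fin l → Set} (P? : ∀ i → Dec (P i)) → ¬ ∃ P → ∣ comprehension P? ∣ ≡ 0
      empty P? ¬P = ∣Empty∣ λ (i , i∈) → ¬P (i , ∈-comprehension⁻ P? i∈)

  flats-correspond⇒Iso : Iso M N
  flats-correspond⇒Iso
    with π , commutes ← equal-fibres⇒permutation _≟ˢ_ (proj₁ ∘ point) (λ j → cl N ⁅ j ⁆) equal-fibres = record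
    { σ        = π
    ; preserve = λ X → ≤-antisym (upper X) (lower X)
    }
    where
    image : Subset n → Subset k
    image X = tabulate (λ j → lookup X (Inverse.from π j))

    ∈-image⁺ : ∀ X {i} → i ∈ X → (π ⟨$⟩ʳ i) ∈ image X
    ∈-image⁺ X {i} i∈X = lookup⇒[]= (π ⟨$⟩ʳ i) _ (trans (lookup∘tabulate _ (π ⟨$⟩ʳ i))
      (trans (cong (lookup X) (inverseˡ π)) ([]=⇒lookup i∈X)))

    ∈-image⁻ : ∀ X {j} → j ∈ image X → (π ⟨$⟩ˡ j) ∈ X
    ∈-image⁻ X {j} j∈ = lookup⇒[]= _ X (trans (sym (lookup∘tabulate _ j)) ([]=⇒lookup j∈))

    flat⁺ : ∀ {F F′ i} → F ~ F′ → i ∈ proj₁ F → (π ⟨$⟩ʳ i) ∈ proj₁ F′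
    flat⁺ {_ , flF} {i = i} F~F′ i∈F = mono (~point i) F~F′ (cl-⊆-flat M flF i∈F)
      (⊆-reflexive (commutes i) (∈cl N (π ⟨$⟩ʳ i)))

    flat⁻ : ∀ {F F′ i} → F ~ F′ → (π ⟨$⟩ʳ i) ∈ proj₁ F′ → i ∈ proj₁ F
    flat⁻ {F′ = _ , flF′} {i} F~F′ πi∈ = reflect (~point i) F~F′
      (⊆-trans (⊆-reflexive (sym (commutes i))) (cl-⊆-flat N flF′ πi∈)) (∈cl M i)

    -- `image X` lies inside the partner of `cl M X`, which has the rank of `X`; `lower` runs the
    -- same argument from `cl N (image X)`.
    upper : ∀ X → r N (image X) ≤ r M X
    upper X with F′ , X~F′ ← total (span M X) = begin
      r N (image X)  ≤⟨ r-mono N (λ j∈ → subst (_∈ proj₁ F′) (inverseʳ π)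
                          (flat⁺ X~F′ (⊆cl M X (∈-image⁻ X j∈)))) ⟩
      r N (proj₁ F′) ≡⟨ ~-rank X~F′ ⟨
      r M (cl M X)   ≡⟨ r-cl M X ⟩
      r M X          ∎
      where open ≤-Reasoning

    lower : ∀ X → r M X ≤ r N (image X)
    lower X with F , F~X ← cototal (span N (image X)) = begin
      r M X                 ≤⟨ r-mono M (λ i∈X → flat⁻ F~X (⊆cl N (image X) (∈-image⁺ X i∈X))) ⟩
      r M (proj₁ F)         ≡⟨ ~-rank F~X ⟩
      r N (cl N (image X))  ≡⟨ r-cl N (image X) ⟩
      r N (image X)         ∎
      where open ≤-Reasoning

-- Recovering the flats of M from the cyclic flats of Q \ a

-- The cyclic flats of Q \ a: zz Z stands for Z ∈ 𝒵(M), and qq F for q(F) \ a.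
data Code (M : Matroid n) : Set where
  zz : ∀ Z → IsCyclicFlat M Z → Code M
  qq : ∀ F → IsFlat M F → Nonempty F → Code M

Codes : ℕ → Matroid n → SizedPoset
Codes m M = record { Carrier = Code M ; _⊑_ = _⊑ᶜ_ ; size = sizeᶜ ; rank = rankᶜ }
  where
  _⊑ᶜ_ : Code M → Code M → Set
  zz Z _   ⊑ᶜ zz Z′ _  = Z ⊆ Z′
  zz Z _   ⊑ᶜ qq F _ _ = Z ⊆ F
  -- A cone over a nonempty flat contains elements of T when `m` is positive, so it is never
  -- contained in E.
  qq _ _ _ ⊑ᶜ zz _ _   = Absurd
  qq F _ _ ⊑ᶜ qq G _ _ = F ⊆ G

  sizeᶜ : Code M → ℕ
  sizeᶜ (zz Z _)   = ∣ Z ∣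
  -- Without the tip, each element of `F` contributes itself and its `m` companions.
  sizeᶜ (qq F _ _) = suc m * ∣ F ∣

  rankᶜ : Code M → ℕ
  rankᶜ (zz Z _)   = r M Z
  rankᶜ (qq F _ _) = suc (r M F)

private
  Nonempty-size : ∀ m {X : Subset n} {Y : Subset k} → ∣ X ∣ ≡ suc m * ∣ Y ∣ → Nonempty Y → Nonempty X
  Nonempty-size m eq ne = 0<⇒Nonempty (subst (0 <_) (sym eq) (≤-trans (Nonempty⇒0< ne) (m≤m+n _ _)))

module _ {m} (1<m : 1 < m) {M : Matroid n} {N : Matroid k}
         (C : Correspondence (Codes m M) (Codes m N)) where

  open Correspondence C

  -- Let G be a flat of corank 1 in F, let zz Y ~ qq G, qq Y ~ qq F′ and qq Z ~ qq K.
  -- Then F and F′ are the only flats covering G below K, so |K| + |G| ≤ |F| + |F′|.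
  -- As |K| = |Z| = (m+1)|F| and |F′| = |Y| = (m+1)|G|, this forces |F| ≤ |G|.
  cyclic≁cone : ∀ {Z cZ F flF neF} t → r N F ≡ suc (suc t) → ¬ (zz Z cZ ~ qq F flF neF)
  cyclic≁cone {Z} {cZ} {F} {flF} {neF} t rF Z~F
    with G , flG , G⊆F , rG ← subflat-of-rank N (suc t) flF (≤-trans (n≤1+n _) (≤-reflexive (sym rF)))
    with neG ← r>0⇒Nonempty N {G} (subst (0 <_) (sym rG) (s≤s z≤n))
    with cototal (qq G flG neG)
  -- Here and in the two later impossible cases, the correspondence would put a `qq` code below a
  -- `zz` code.
  ... | qq _ _ _ , Y~G = reflect Y~G Z~F G⊆F
  ... | zz Y cY , Y~G
    with total (qq Y (proj₁ cY) (Nonempty-size m (~-size Y~G) neG))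
       | total (qq Z (proj₁ cZ) (Nonempty-size m (~-size Z~F) neF))
  ... | zz _ _ , qY~ | _ = mono Y~G qY~ ⊆-refl
  ... | qq _ _ _ , _ | zz _ _ , qZ~ = mono Z~F qZ~ ⊆-refl
  ... | qq F′ flF′ neF′ , Y~F′ | qq K flK neK , Z~K =
    contradiction (r-mono N (∣⊇∣≤⇒⊆ G⊆F ∣F∣≤∣G∣)) (<⇒≱ (subst₂ _<_ (sym rG) (sym rF) (n<1+n _)))
    where
    G⊆F′ : G ⊆ F′
    G⊆F′ = mono Y~G Y~F′ ⊆-refl

    F′⊆K : F′ ⊆ K
    F′⊆K = mono Y~F′ Z~K (reflect Y~G Z~F G⊆F)

    module _ {e} (e∈K : e ∈ K) (e∉F : e ∉ F) (e∉F′ : e ∉ F′) where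
      H : Subset k
      H = cl N (G ∪ ⁅ e ⁆)

      e∈H : e ∈ H
      e∈H = ⊆cl N _ (q⊆p∪q G _ (x∈⁅x⁆ e))

      H⊆K : H ⊆ K
      H⊆K = cl-least N flK (∪-least (F′⊆K ∘ G⊆F′) (⁅⁆⊆ e∈K))

      no-third-cover : Absurd
      no-third-cover with cototal (qq H (cl-flat N _) (e , e∈H))
      -- A `zz` code below `qq Z` is also below `zz Z`, which would force `H ⊆ F`.
      ... | zz _ _ , H~ = e∉F (mono H~ Z~F (reflect H~ Z~K H⊆K) e∈H)
      ... | qq H′ flH′ neH′ , H~ = e∉F′ (mono H~ Y~F′ H′⊆Y e∈H)
        where
        H′⊆Y : H′ ⊆ Y
        -- The shift by one in the rank of cones decides: `zz Y ~ qq G` gives `Y` rank `r(G) + 1`,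
        -- while `qq H′ ~ qq H` gives `H′` the rank of `H`, at most `r(G) + 1`. So `H′` cannot
        -- outgrow its subset `Y`.
        H′⊆Y = flat-absorbs M (proj₁ cY) ⊆-refl (reflect Y~G H~ (⊆cl N _ ∘ p⊆p∪q _)) (begin
          r M H′             ≡⟨ suc-injective (~-rank H~) ⟩
          r N H              ≡⟨ r-cl N _ ⟩
          r N (G ∪ ⁅ e ⁆)    ≤⟨ r-∪⁅⁆ N G e ⟩
          suc (r N G)        ≡⟨ ~-rank Y~G ⟨
          r M Y              ∎)
          where open ≤-Reasoning

    K⊆F∪F′ : K ⊆ F ∪ F′
    K⊆F∪F′ {e} e∈K with e ∈? F | e ∈? F′
    ... | yes e∈F | _        = p⊆p∪q F′ e∈F
    ... | no _    | yes e∈F′ = q⊆p∪q F F′ e∈F′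
    ... | no e∉F  | no e∉F′  = ⊥-elim (no-third-cover e∈K e∉F e∉F′)

    ∣F′∣ : ∣ F′ ∣ ≡ suc m * ∣ G ∣
    ∣F′∣ = trans (sym (*-cancelˡ-≡ _ _ (suc m) (~-size Y~F′))) (~-size Y~G)

    ∣K∣ : ∣ K ∣ ≡ suc m * ∣ F ∣
    ∣K∣ = trans (sym (*-cancelˡ-≡ _ _ (suc m) (~-size Z~K))) (~-size Z~F)

    ∣F∣≤∣G∣ : ∣ F ∣ ≤ ∣ G ∣
    ∣F∣≤∣G∣ = *-cancelˡ-≤ m {{>-nonZero (≤-trans (s≤s z≤n) 1<m)}}
      (+-cancelˡ-≤ ∣ G ∣ _ _ (+-cancelˡ-≤ ∣ F ∣ _ _ (begin
        ∣ F ∣ + (∣ G ∣ + m * ∣ F ∣)   ≡⟨ cong (∣ F ∣ +_) (+-comm ∣ G ∣ _) ⟩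
        ∣ F ∣ + (m * ∣ F ∣ + ∣ G ∣)   ≡⟨ +-assoc ∣ F ∣ _ _ ⟨
        suc m * ∣ F ∣ + ∣ G ∣         ≡⟨ cong (_+ ∣ G ∣) ∣K∣ ⟨
        ∣ K ∣ + ∣ G ∣                 ≤⟨ +-mono-≤ (p⊆q⇒∣p∣≤∣q∣ K⊆F∪F′)
                                          (p⊆q⇒∣p∣≤∣q∣ (λ x∈ → x∈p∩q⁺ (G⊆F x∈ , G⊆F′ x∈))) ⟩
        ∣ F ∪ F′ ∣ + ∣ F ∩ F′ ∣       ≡⟨ ∣∪∣+∣∩∣ F F′ ⟩
        ∣ F ∣ + ∣ F′ ∣                ≡⟨ cong (∣ F ∣ +_) ∣F′∣ ⟩
        ∣ F ∣ + suc m * ∣ G ∣         ∎)))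
      where open ≤-Reasoning

-- After one removal the set is still nonempty, hence of positive rank.
loopless-rank≤1-cyclic : (M : Matroid n) → Loopless M → ∀ {X} → r M X ≤ 1 → 2 ≤ ∣ X ∣ → IsCyclic M X
loopless-rank≤1-cyclic M ll {X} r≤1 2≤ e _ = ≤-antisym (r-mono M (p─q⊆p X _))
  (≤-trans r≤1 (loopless⇒0<r M ll (0<⇒Nonempty (s≤s⁻¹ (≤-trans 2≤ (∣∣≤suc∣-∣ X e))))))

-- In Q \ a, the set q(P) \ a for a point P can be indistinguishable from a cyclic line:
-- zz Z and qq P may be interchanged for a line Z on P with |Z| = (m+1)|P|.
module _ {M : Matroid n} {N : Matroid k} (_~_ : Code M → Code N → Set) where

  data Matched : Carrier (Flats M) → Carrier (Flats N) → Set where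
    empty   : ∀ {F F′} → Empty (proj₁ F) → Empty (proj₁ F′) → Matched F F′
    direct  : ∀ {F flF neF F′ flF′ neF′} → qq F flF neF ~ qq F′ flF′ neF′ → Matched (F , flF) (F′ , flF′)
    swapped : ∀ {P flP neP P′ flP′ neP′ Z cZ flZ neZ L cL flL neL} →
              qq P flP neP ~ zz L cL → zz Z cZ ~ qq P′ flP′ neP′ → qq Z flZ neZ ~ qq L flL neL →
              Matched (P , flP) (P′ , flP′)

Matched-flip : ∀ {M : Matroid n} {N : Matroid k} {_~_ : Code M → Code N → Set} {F F′} →
               Matched (λ b a → a ~ b) F′ F → Matched _~_ F F′
Matched-flip (empty eF′ eF)         = empty eF eF′
Matched-flip (direct F~F′)          = direct F~F′
Matched-flip (swapped P~L Z~P′ Z~L) = swapped Z~P′ P~L Z~L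

module _ {m} {M : Matroid n} {N : Matroid k} (C : Correspondence (Codes m M) (Codes m N)) where

  open Correspondence C

  -- In the swapped case the comparison passes through the lines: P is compared with `L`, `L` with
  -- `Z` through their cones, and `Z` with P′.
  Matched-size : ∀ {F F′} → Matched _~_ F F′ → ∣ proj₁ F ∣ ≡ ∣ proj₁ F′ ∣
  Matched-size (empty eF eF′) = trans (∣Empty∣ eF) (sym (∣Empty∣ eF′))
  Matched-size (direct F~F′) = *-cancelˡ-≡ _ _ (suc m) (~-size F~F′)
  Matched-size (swapped P~L Z~P′ Z~L) = *-cancelˡ-≡ _ _ (suc m)
    (trans (~-size P~L) (trans (sym (*-cancelˡ-≡ _ _ (suc m) (~-size Z~L))) (~-size Z~P′)))

  Matched-rank : ∀ {F F′} → Matched _~_ F F′ → r M (proj₁ F) ≡ r N (proj₁ F′)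
  Matched-rank (empty eF eF′) = trans (r-⊥ M eF) (sym (r-⊥ N eF′))
  Matched-rank (direct F~F′) = suc-injective (~-rank F~F′)
  Matched-rank (swapped P~L Z~P′ Z~L) =
    suc-injective (trans (~-rank P~L) (trans (sym (suc-injective (~-rank Z~L))) (~-rank Z~P′)))

  -- The swapped cases rest on reading one inclusion in several ways: `L ⊆ G′` means both
  -- `zz L ⊑ qq G′` and `qq L ⊑ qq G′`, and likewise for `Z ⊆ G`. This carries an inclusion from P
  -- to `L`, then to `Z`, then to P′.
  Matched-mono : ∀ {F F′ G G′} → Matched _~_ F F′ → Matched _~_ G G′ → proj₁ F ⊆ proj₁ G → proj₁ F′ ⊆ proj₁ G′
  Matched-mono (empty _ eF′) _ _ x∈F′ = contradiction (_ , x∈F′) eF′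
  Matched-mono (direct {neF = e , e∈F} _) (empty eG _) F⊆G = contradiction (e , F⊆G e∈F) eG
  Matched-mono (swapped {neP = e , e∈P} _ _ _) (empty eG _) P⊆G = contradiction (e , P⊆G e∈P) eG
  Matched-mono (direct F~F′) (direct G~G′) F⊆G = mono F~F′ G~G′ F⊆G
  Matched-mono (direct F~F′) (swapped P~L _ _) F⊆P = ⊥-elim (mono F~F′ P~L F⊆P)
  Matched-mono (swapped P~L Z~P′ Z~L) (direct G~G′) P⊆G =
    mono Z~P′ G~G′ (reflect Z~L G~G′ (mono P~L G~G′ P⊆G))
  Matched-mono (swapped P~L Z~P′ Z~L) (swapped P~L₁ Z~P′₁ Z~L₁) P⊆P₁ =
    mono Z~P′ Z~P′₁ (reflect Z~L Z~L₁ (mono P~L P~L₁ P⊆P₁))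

module _ {m} (1<m : 1 < m) {M : Matroid n} {N : Matroid k} (llM : Loopless M) (llN : Loopless N)
         (C : Correspondence (Codes m M) (Codes m N)) where

  open Correspondence C

  private
    -- Cancelling `p` leaves `m * p ≤ 1`, against `m ≥ 2` and `p ≥ 1`.
    too-big : ∀ {p} → 0 < p → ¬ (suc m * p ≤ suc p)
    too-big {p} 0<p le = contradiction (+-cancelʳ-≤ p (m * p) 1 (≤-trans (≤-reflexive (+-comm (m * p) p)) le))
      (<⇒≱ (*-mono-≤ 1<m 0<p))

    positive-cases : ∀ {i} → 0 < i → i ≡ 1 ⊎ ∃ λ t → i ≡ suc (suc t)
    positive-cases {suc zero}    _ = inj₁ refl
    positive-cases {suc (suc t)} _ = inj₂ (t , refl)

  match-point : ∀ {P flP neP L cL} → r M P ≡ 1 → qq P flP neP ~ zz L cL → ∃ λ P′ → Matched _~_ (P , flP) P′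
  match-point {P} {flP} {neP} {L} {cL} rP≡1 P~L
    with cototal (qq L (proj₁ cL) (Nonempty-size m (sym (~-size P~L)) neP))
  ... | zz _ _ , Z~L = ⊥-elim (cyclic≁cone 1<m C 0 (trans (sym (~-rank P~L)) (cong suc rP≡1)) Z~L)
  ... | qq Z flZ neZ , Z~L with cyclic⊎coloop M Z
  -- If the line `Z` had a coloop `e`, then `Z - e` would be a flat of rank at most 1 with at least
  -- two elements, since `|Z| = (m+1)|P| ≥ 3`; so it would be cyclic. Its partner has rank at most
  -- 1, hence is no cone but a cyclic flat inside `L`. Pulling this back along `P~L` puts `Z - e`
  -- inside `P`, which is too small.
  ...   | inj₂ (e , e∈Z , lt) = ⊥-elim absurd
    where
    ∣Z∣ : ∣ Z ∣ ≡ suc m * ∣ P ∣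
    ∣Z∣ = trans (*-cancelˡ-≡ _ _ (suc m) (~-size Z~L)) (sym (~-size P~L))

    r≤1 : r M (Z - e) ≤ 1
    r≤1 = s≤s⁻¹ (≤-trans lt (≤-reflexive (trans (suc-injective (~-rank Z~L)) (trans (sym (~-rank P~L)) (cong suc rP≡1)))))

    2≤∣∣ : 2 ≤ ∣ Z - e ∣
    2≤∣∣ = s≤s⁻¹ (begin
      3                 ≤⟨ *-mono-≤ (s≤s 1<m) (Nonempty⇒0< neP) ⟩
      suc m * ∣ P ∣     ≡⟨ ∣Z∣ ⟨
      ∣ Z ∣             ≤⟨ ∣∣≤suc∣-∣ Z e ⟩
      suc ∣ Z - e ∣     ∎)
      where open ≤-Reasoning

    cP₁ : IsCyclicFlat M (Z - e)
    cP₁ = remove-coloop-flat M flZ e∈Z lt , loopless-rank≤1-cyclic M llM r≤1 2≤∣∣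

    absurd : Absurd
    absurd with total (zz (Z - e) cP₁)
    ... | qq F flF neF , P₁~F =
      contradiction (≤-trans (≤-reflexive (sym (~-rank P₁~F))) r≤1) (<⇒≱ (s≤s (loopless⇒0<r N llN neF)))
    ... | zz P₂ _ , P₁~P₂ = too-big (Nonempty⇒0< neP) (begin
      suc m * ∣ P ∣     ≡⟨ ∣Z∣ ⟨
      ∣ Z ∣             ≤⟨ ∣∣≤suc∣-∣ Z e ⟩
      suc ∣ Z - e ∣     ≤⟨ s≤s (p⊆q⇒∣p∣≤∣q∣ (reflect P₁~P₂ P~L (mono P₁~P₂ Z~L (p─q⊆p Z _)))) ⟩
      suc ∣ P ∣         ∎)
      where open ≤-Reasoning
  ...   | inj₁ cyc with total (zz Z (flZ , cyc))
  ...     | qq P′ flP′ neP′ , Z~P′ = (P′ , flP′) , swapped P~L Z~P′ Z~L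
  -- A cyclic partner of `zz Z` lies in `L`, hence below `zz L`; reflecting along `P~L` gives
  -- `Z ⊆ P`, although `|Z| = (m+1)|P|`.
  ...     | zz _ _ , Z~L₁ = ⊥-elim (too-big (Nonempty⇒0< neP) (begin
      suc m * ∣ P ∣     ≡⟨ ~-size P~L ⟩
      ∣ L ∣             ≡⟨ *-cancelˡ-≡ _ _ (suc m) (~-size Z~L) ⟨
      ∣ Z ∣             ≤⟨ p⊆q⇒∣p∣≤∣q∣ (reflect Z~L₁ P~L (mono Z~L₁ Z~L ⊆-refl)) ⟩
      ∣ P ∣             ≤⟨ n≤1+n _ ⟩
      suc ∣ P ∣         ∎))
    where open ≤-Reasoning

  match : ∀ F → ∃ λ F′ → Matched _~_ F F′
  match (F , flF) with nonempty? F
  ... | no eF = (⊥ , ⊥-flat N llN) , empty eF (∉⊥ ∘ proj₂)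
  ... | yes neF with total (qq F flF neF)
  ...   | qq F′ flF′ neF′ , F~F′ = (F′ , flF′) , direct F~F′
  ...   | zz L cL , F~L with positive-cases (loopless⇒0<r M llM neF)
  ...     | inj₁ rF       = match-point rF F~L
  ...     | inj₂ (t , rF) = ⊥-elim (cyclic≁cone 1<m (flip C) t rF F~L)

codes-correspond⇒flats-correspond : ∀ {m} → 1 < m → {M : Matroid n} {N : Matroid k} → Loopless M → Loopless N →
  Correspondence (Codes m M) (Codes m N) → Correspondence (Flats M) (Flats N)
codes-correspond⇒flats-correspond 1<m llM llN C = record
  { _~_     = Matched _~_
  ; total   = match 1<m llM llN C
  ; cototal = λ F′ → let F , F′~F = match 1<m llN llM (flip C) F′ in F , Matched-flip F′~F
  ; mono    = Matched-mono C
  ; reflect = λ p q → Matched-mono (flip C) (Matched-flip p) (Matched-flip q)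
  ; ~-size  = Matched-size C
  ; ~-rank  = Matched-rank C
  }
  where open Correspondence C using (_~_)

-- The ground set of the free cone

enc : ∀ {n m} → QElem n m → Fin (qsize n m)
enc {n} {m} (eE e)   = e ↑ˡ (n * m + 1)
enc {n} {m} (eT e i) = n ↑ʳ (combine e i ↑ˡ 1)
enc {n} {m} eA       = n ↑ʳ ((n * m) ↑ʳ zero)

decode-enc : ∀ {n m} (q : QElem n m) → decode {n} {m} (enc q) ≡ q
decode-enc {n} {m} (eE e) rewrite splitAt-↑ˡ n e (n * m + 1) = refl
decode-enc {n} {m} (eT e i)
  rewrite splitAt-↑ʳ n (n * m + 1) (combine e i ↑ˡ 1)
        | splitAt-↑ˡ (n * m) (combine e i) 1
  = cong (λ (d , l) → eT d l) (remQuot-combine e i)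
decode-enc {n} {m} eA
  rewrite splitAt-↑ʳ n (n * m + 1) ((n * m) ↑ʳ zero)
        | splitAt-↑ʳ (n * m) 1 zero = refl

enc-surjective : ∀ {n m} (j : Fin (qsize n m)) → ∃ λ q → enc {n} {m} q ≡ j
enc-surjective {n} {m} j with splitAt n j in eq
... | inj₁ e = eE e , splitAt⁻¹-↑ˡ eq
... | inj₂ t with splitAt (n * m) t in eq′
...   | inj₂ zero = eA , trans (cong (n ↑ʳ_) (splitAt⁻¹-↑ʳ eq′)) (splitAt⁻¹-↑ʳ eq)
...   | inj₁ u with e , i , refl ← combine-surjective {n} {m} u =
  eT e i , trans (cong (n ↑ʳ_) (splitAt⁻¹-↑ˡ eq′)) (splitAt⁻¹-↑ʳ eq)

enc-injective : ∀ {n m} {p q : QElem n m} → enc p ≡ enc q → p ≡ q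
enc-injective {p = p} {q} eq = trans (sym (decode-enc p)) (trans (cong decode eq) (decode-enc q))

⊆-enc : ∀ {n m} {X Y : Subset (qsize n m)} → (∀ q → enc {n} {m} q ∈ X → enc {n} {m} q ∈ Y) → X ⊆ Y
⊆-enc {n} {m} h {j} j∈X with q , refl ← enc-surjective {n} {m} j = h q j∈X

eT-injectiveʳ : ∀ {n m} {e e′ : Fin n} {i i′ : Fin m} → eT e i ≡ eT e′ i′ → i ≡ i′
eT-injectiveʳ refl = refl

base : ∀ {n m} → QElem n m → Maybe (Fin n)
base (eE e)   = just e
base (eT e _) = just e
base eA       = nothing

module _ {n m : ℕ} where

  private
    Tabulated : Subset (qsize n m) → Set
    Tabulated X = ∃ λ f → X ≡ tabulate f

    lookup-enc : ∀ {X q b} ((f , _) : Tabulated X) →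
                 (∀ j → decode {n} {m} j ≡ q → f j ≡ b) → lookup X (enc {n} {m} q) ≡ b
    lookup-enc {q = q} (f , refl) at = trans (lookup∘tabulate f (enc q)) (at (enc q) (decode-enc q))

    -- The defining functions are local to their definitions; unification names them.
    embedE-tab : ∀ Z → Tabulated (embedE {n} {m} Z)
    embedE-tab Z = _ , refl

    qOf-tab : ∀ F → Tabulated (qOf {n} {m} F)
    qOf-tab F = _ , refl

    minusA-tab : Tabulated (groundMinusA n m)
    minusA-tab = _ , refl

    minusE-tab : Tabulated (groundMinusE n m)
    minusE-tab = _ , refl

    T-tab : Tabulated (groundT n m)
    T-tab = _ , refl

  embedE-E : ∀ Z e → lookup (embedE {n} {m} Z) (enc {n} {m} (eE e)) ≡ lookup Z e
  embedE-E Z e = lookup-enc (embedE-tab Z) at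
    where
    at : ∀ j → decode {n} {m} j ≡ eE e → proj₁ (embedE-tab Z) j ≡ lookup Z e
    at j eq rewrite eq = refl

  embedE-T : ∀ Z e i → lookup (embedE {n} {m} Z) (enc {n} {m} (eT e i)) ≡ outside
  embedE-T Z e i = lookup-enc (embedE-tab Z) at
    where
    at : ∀ j → decode {n} {m} j ≡ eT e i → proj₁ (embedE-tab Z) j ≡ outside
    at j eq rewrite eq = refl

  embedE-A : ∀ Z → lookup (embedE {n} {m} Z) (enc {n} {m} eA) ≡ outside
  embedE-A Z = lookup-enc (embedE-tab Z) at
    where
    at : ∀ j → decode {n} {m} j ≡ eA → proj₁ (embedE-tab Z) j ≡ outside
    at j eq rewrite eq = refl

  qOf-base : ∀ F q {e} → base q ≡ just e → lookup (qOf {n} {m} F) (enc {n} {m} q) ≡ lookup F e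
  qOf-base F (eE e) refl = lookup-enc (qOf-tab F) at
    where
    at : ∀ j → decode {n} {m} j ≡ eE e → proj₁ (qOf-tab F) j ≡ lookup F e
    at j eq rewrite eq = refl
  qOf-base F (eT e i) refl = lookup-enc (qOf-tab F) at
    where
    at : ∀ j → decode {n} {m} j ≡ eT e i → proj₁ (qOf-tab F) j ≡ lookup F e
    at j eq rewrite eq = refl

  qOf-A : ∀ F → lookup (qOf {n} {m} F) (enc {n} {m} eA) ≡ inside
  qOf-A F = lookup-enc (qOf-tab F) at
    where
    at : ∀ j → decode {n} {m} j ≡ eA → proj₁ (qOf-tab F) j ≡ inside
    at j eq rewrite eq = refl

  -- All three restrictions keep T, so two Booleans, for E and for the tip, describe them uniformly.
  groundPart : Bool → Bool → QElem n m → Bool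
  groundPart hasE hasA (eE _)   = hasE
  groundPart hasE hasA (eT _ _) = inside
  groundPart hasE hasA eA       = hasA

  IsGround : Bool → Bool → Subset (qsize n m) → Set
  IsGround hasE hasA S = ∀ q → lookup S (enc q) ≡ groundPart hasE hasA q

  groundMinusA-isGround : IsGround true false (groundMinusA n m)
  groundMinusA-isGround q = lookup-enc minusA-tab at
    where
    at : ∀ j → decode {n} {m} j ≡ q → proj₁ minusA-tab j ≡ groundPart true false q
    at j refl with decode {n} {m} j
    ... | eE _   = refl
    ... | eT _ _ = refl
    ... | eA     = refl

  groundMinusE-isGround : IsGround false true (groundMinusE n m)
  groundMinusE-isGround q = lookup-enc minusE-tab at
    where
    at : ∀ j → decode {n} {m} j ≡ q → proj₁ minusE-tab j ≡ groundPart false true q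
    at j refl with decode {n} {m} j
    ... | eE _   = refl
    ... | eT _ _ = refl
    ... | eA     = refl

  groundT-isGround : IsGround false false (groundT n m)
  groundT-isGround q = lookup-enc T-tab at
    where
    at : ∀ j → decode {n} {m} j ≡ q → proj₁ T-tab j ≡ groundPart false false q
    at j refl with decode {n} {m} j
    ... | eE _   = refl
    ... | eT _ _ = refl
    ... | eA     = refl

  private
    transport : ∀ {l} {X : Subset l} {Y : Subset k} {i j} → lookup X i ≡ lookup Y j → i ∈ X → j ∈ Y
    transport {Y = Y} {j = j} eq i∈X = lookup⇒[]= j Y (trans (sym eq) ([]=⇒lookup i∈X))

    outside⇒∉ : ∀ {l} {X : Subset l} {i} → lookup X i ≡ outside → i ∉ X
    outside⇒∉ eq i∈X = contradiction (trans (sym ([]=⇒lookup i∈X)) eq) λ ()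

  ∈embedE⁺ : ∀ {Z e} → e ∈ Z → enc (eE e) ∈ embedE {n} {m} Z
  ∈embedE⁺ {Z} {e} = transport (sym (embedE-E Z e))

  ∈embedE⁻ : ∀ {Z} q → enc q ∈ embedE {n} {m} Z → ∃ λ e → q ≡ eE e × e ∈ Z
  ∈embedE⁻ {Z} (eE e)   q∈ = e , refl , transport (embedE-E Z e) q∈
  ∈embedE⁻ {Z} (eT e i) q∈ = contradiction q∈ (outside⇒∉ (embedE-T Z e i))
  ∈embedE⁻ {Z} eA       q∈ = contradiction q∈ (outside⇒∉ (embedE-A Z))

  ∈qOf⁺ : ∀ {F e} q → base q ≡ just e → e ∈ F → enc q ∈ qOf {n} {m} F
  ∈qOf⁺ {F} q bq = transport (sym (qOf-base F q bq))

  ∈qOf⁻ : ∀ {F e} q → base q ≡ just e → enc q ∈ qOf {n} {m} F → e ∈ F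
  ∈qOf⁻ {F} q bq = transport (qOf-base F q bq)

  A∈qOf : ∀ F → enc {n} {m} eA ∈ qOf {n} {m} F
  A∈qOf F = lookup⇒[]= (enc {n} {m} eA) _ (qOf-A F)

  ∈ground : ∀ {hasE hasA S} → IsGround hasE hasA S → ∀ q → groundPart hasE hasA q ≡ inside → enc q ∈ S
  ∈ground ground q eq = lookup⇒[]= (enc q) _ (trans (ground q) eq)

  ∉ground : ∀ {hasE hasA S} → IsGround hasE hasA S → ∀ q → groundPart hasE hasA q ≡ outside → enc q ∉ S
  ∉ground ground q eq = outside⇒∉ (trans (ground q) eq)

  private
    ∣tabulate∣-+ : ∀ a {b} (f : Fin (a + b) → Bool) →
                   ∣ tabulate f ∣ ≡ ∣ tabulate (f ∘ (_↑ˡ b)) ∣ + ∣ tabulate (f ∘ (a ↑ʳ_)) ∣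
    ∣tabulate∣-+ zero    f = refl
    ∣tabulate∣-+ (suc a) f with f zero
    ... | inside  = cong suc (∣tabulate∣-+ a (f ∘ suc))
    ... | outside = ∣tabulate∣-+ a (f ∘ suc)

    -- `∣ b ∷ [] ∣` is the Boolean `b` as a number, 1 or 0, here and in the size formulas that
    -- follow.
    ∣constant∣ : ∀ l b → ∣ tabulate {n = l} (λ _ → b) ∣ ≡ ∣ b ∷ [] ∣ * l
    ∣constant∣ zero    inside  = refl
    ∣constant∣ zero    outside = refl
    ∣constant∣ (suc l) inside  = cong suc (∣constant∣ l inside)
    ∣constant∣ (suc l) outside = ∣constant∣ l outside

    ∣tabulate∣-* : ∀ a l (f : Fin (a * l) → Bool) (g : Fin a → Bool) →
                   (∀ e i → f (combine e i) ≡ g e) → ∣ tabulate f ∣ ≡ ∣ tabulate g ∣ * l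
    ∣tabulate∣-* zero    l f g eq = refl
    ∣tabulate∣-* (suc a) l f g eq = begin
      ∣ tabulate f ∣
        ≡⟨ ∣tabulate∣-+ l f ⟩
      ∣ tabulate (f ∘ (_↑ˡ (a * l))) ∣ + ∣ tabulate (f ∘ (l ↑ʳ_)) ∣
        ≡⟨ cong₂ _+_ (trans (cong ∣_∣ (tabulate-cong (eq zero))) (∣constant∣ l (g zero)))
                     (∣tabulate∣-* a l (f ∘ (l ↑ʳ_)) (g ∘ suc) (λ e → eq (suc e))) ⟩
      ∣ g zero ∷ [] ∣ * l + ∣ tabulate (g ∘ suc) ∣ * l
        ≡⟨ *-distribʳ-+ l ∣ g zero ∷ [] ∣ _ ⟨
      (∣ g zero ∷ [] ∣ + ∣ tabulate (g ∘ suc) ∣) * l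
        ≡⟨ cong (_* l) (head (g zero)) ⟩
      ∣ tabulate g ∣ * l ∎
      where
      open ≡-Reasoning
      head : ∀ b → ∣ b ∷ [] ∣ + ∣ tabulate (g ∘ suc) ∣ ≡ ∣ b ∷ tabulate (g ∘ suc) ∣
      head inside  = refl
      head outside = refl

  ∣∣-enc : ∀ (X : Subset (qsize n m)) (gE gT : Fin n → Bool) b →
           (∀ e → lookup X (enc {n} {m} (eE e)) ≡ gE e) →
           (∀ e i → lookup X (enc {n} {m} (eT e i)) ≡ gT e) →
           lookup X (enc {n} {m} eA) ≡ b →
           ∣ X ∣ ≡ ∣ tabulate gE ∣ + (∣ tabulate gT ∣ * m + ∣ b ∷ [] ∣)
  ∣∣-enc X gE gT b onE onT onA = begin
    ∣ X ∣ ≡⟨ cong ∣_∣ (tabulate∘lookup X) ⟨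
    ∣ tabulate (lookup X) ∣ ≡⟨ ∣tabulate∣-+ n (lookup X) ⟩
    ∣ tabulate (λ e → lookup X (enc {n} {m} (eE e))) ∣ + ∣ tabulate (λ t → lookup X (n ↑ʳ t)) ∣
      ≡⟨ cong₂ _+_ (cong ∣_∣ (tabulate-cong onE)) (∣tabulate∣-+ (n * m) (λ t → lookup X (n ↑ʳ t))) ⟩
    ∣ tabulate gE ∣ + (∣ tabulate (λ u → lookup X (n ↑ʳ (u ↑ˡ 1))) ∣ + ∣ lookup X (enc {n} {m} eA) ∷ [] ∣)
      ≡⟨ cong (∣ tabulate gE ∣ +_) (cong₂ _+_ (∣tabulate∣-* n m _ gT onT) (cong (λ a → ∣ a ∷ [] ∣) onA)) ⟩
    ∣ tabulate gE ∣ + (∣ tabulate gT ∣ * m + ∣ b ∷ [] ∣) ∎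
    where open ≡-Reasoning

  ∣embedE∣ : ∀ Z → ∣ embedE {n} {m} Z ∣ ≡ ∣ Z ∣
  ∣embedE∣ Z = begin
    ∣ embedE {n} {m} Z ∣
      ≡⟨ ∣∣-enc (embedE {n} {m} Z) (lookup Z) (λ _ → outside) outside (embedE-E Z) (embedE-T Z) (embedE-A Z) ⟩
    ∣ tabulate (lookup Z) ∣ + (∣ tabulate {n = n} (λ _ → outside) ∣ * m + 0)
      ≡⟨ cong₂ _+_ (cong ∣_∣ (tabulate∘lookup Z)) (trans (+-identityʳ _) (cong (_* m) (∣constant∣ n outside))) ⟩
    ∣ Z ∣ + 0 ≡⟨ +-identityʳ _ ⟩
    ∣ Z ∣ ∎
    where open ≡-Reasoning

  ∣qOf∩∣ : ∀ {hasE hasA S} → IsGround hasE hasA S → ∀ F →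
           ∣ qOf {n} {m} F ∩ S ∣ ≡ ∣ hasE ∷ [] ∣ * ∣ F ∣ + (∣ F ∣ * m + ∣ hasA ∷ [] ∣)
  ∣qOf∩∣ {hasE} {hasA} {S} ground F = begin
    ∣ qOf {n} {m} F ∩ S ∣
      ≡⟨ ∣∣-enc (qOf {n} {m} F ∩ S) (λ e → lookup F e ∧ hasE) (lookup F) hasA
           (λ e → trans (lookup-zipWith _∧_ (enc {n} {m} (eE e)) (qOf F) S) (cong₂ _∧_ (qOf-base F (eE e) refl) (ground (eE e))))
           (λ e i → trans (lookup-zipWith _∧_ (enc {n} {m} (eT e i)) (qOf F) S)
             (trans (cong₂ _∧_ (qOf-base F (eT e i) refl) (ground (eT e i))) (Bool.∧-identityʳ _)))
           (trans (lookup-zipWith _∧_ (enc {n} {m} eA) (qOf F) S) (cong₂ _∧_ (qOf-A F) (ground eA))) ⟩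
    ∣ tabulate (λ e → lookup F e ∧ hasE) ∣ + (∣ tabulate (lookup F) ∣ * m + ∣ hasA ∷ [] ∣)
      ≡⟨ cong₂ (λ x y → x + (y * m + ∣ hasA ∷ [] ∣)) (E-part hasE) (cong ∣_∣ (tabulate∘lookup F)) ⟩
    ∣ hasE ∷ [] ∣ * ∣ F ∣ + (∣ F ∣ * m + ∣ hasA ∷ [] ∣) ∎
    where
    open ≡-Reasoning
    E-part : ∀ b → ∣ tabulate (λ e → lookup F e ∧ b) ∣ ≡ ∣ b ∷ [] ∣ * ∣ F ∣
    E-part inside  = trans (cong ∣_∣ (trans (tabulate-cong (λ e → Bool.∧-identityʳ _)) (tabulate∘lookup F)))
                           (sym (+-identityʳ _))
    E-part outside = trans (cong ∣_∣ (tabulate-cong (λ e → Bool.∧-zeroʳ (lookup F e)))) (∣constant∣ n outside)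

-- Restrictions of the free cone

-- Choosing one element of {e} ∪ T_e for every e ∈ F, and one further element outside E,
-- already spans q(F).
record Transversal {n m : ℕ} (F : Subset n) (Y : Subset (qsize n m)) : Set where
  field
    choice      : Fin n → QElem n m
    choice-base : ∀ e → base (choice e) ≡ just e
    choice∈     : ∀ {e} → e ∈ F → enc (choice e) ∈ Y
    extra       : QElem n m
    extra∈      : enc extra ∈ Y
    extra∉E     : ∀ e → extra ≢ eE e
    extra≢      : ∀ e → extra ≢ choice e

module _ {n m : ℕ} {M : Matroid n} {Q : Matroid (qsize n m)} (cone : IsFreeCone M m Q) where

  open IsFreeCone cone

  module _ {F : Subset n} {Y : Subset (qsize n m)} (t : Transversal F Y) where

    open Transversal t

    private
      choice-injective : ∀ {e e′} → enc (choice e) ≡ enc (choice e′) → e ≡ e′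
      choice-injective {e} {e′} eq = just-injective
        (trans (sym (choice-base e)) (trans (cong base (enc-injective eq)) (choice-base e′)))

      ∣─qOf∣ : ∀ G → ∣ F ─ G ∣ ≤ ∣ Y ─ qOf {n} {m} G ∣
      ∣─qOf∣ G = injection⇒∣∣≤ (enc ∘ choice) (F ─ G) (Y ─ qOf {n} {m} G)
        (λ {e} e∈ → x∈p∧x∉q⇒x∈p─q (choice∈ (p─q⊆p F G e∈))
          (∈─⇒∉ F G e∈ ∘ ∈qOf⁻ (choice e) (choice-base e)))
        (λ _ _ → choice-injective)

      ∣─embedE∣ : ∀ Z → suc ∣ F ─ Z ∣ ≤ ∣ Y ─ embedE {n} {m} Z ∣
      ∣─embedE∣ Z = ≤-trans
        (s≤s (injection⇒∣∣≤ (enc ∘ choice) (F ─ Z) (Y ─ embedE {n} {m} Z - enc extra)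
          (λ {e} e∈ → x∈p∧x≢y⇒x∈p-y
            (x∈p∧x∉q⇒x∈p─q (choice∈ (p─q⊆p F Z e∈)) (∉embedE (∈─⇒∉ F Z e∈)))
            (extra≢ e ∘ sym ∘ enc-injective))
          (λ _ _ → choice-injective)))
        (x∈p⇒∣p-x∣<∣p∣ (x∈p∧x∉q⇒x∈p─q extra∈ λ extra∈Z →
          let e , eq , _ = ∈embedE⁻ extra extra∈Z in extra∉E e eq))
        where
        ∉embedE : ∀ {e} → e ∉ Z → enc (choice e) ∉ embedE {n} {m} Z
        ∉embedE {e} e∉Z c∈ with e′ , eq , e′∈Z ← ∈embedE⁻ (choice e) c∈ =
          e∉Z (subst (_∈ Z) (just-injective (trans (sym (cong base eq)) (choice-base e))) e′∈Z)

    -- Some cyclic flat of `Q` satisfies the bound of `rank-witness` for `Y`. If it is q(G), its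
    -- rank already contains the extra 1, and the chosen elements over `F ─ G` lie outside it. If it
    -- comes from `M`, the missing 1 is supplied by `extra`, which lies outside E.
    transversal-rank : suc (r M F) ≤ r Q Y
    transversal-rank with Z , cf , le ← rank-witness Q Y with Equivalence.to (cyclicFlats Z) cf
    ... | inj₁ (Z′ , cf′ , refl) = begin
      suc (r M F)                        ≤⟨ s≤s (r-─ M F Z′) ⟩
      suc (r M Z′ + ∣ F ─ Z′ ∣)          ≡⟨ +-suc _ _ ⟨
      r M Z′ + suc ∣ F ─ Z′ ∣            ≤⟨ +-monoʳ-≤ (r M Z′) (∣─embedE∣ Z′) ⟩
      r M Z′ + ∣ Y ─ embedE {n} {m} Z′ ∣         ≡⟨ cong (_+ ∣ Y ─ embedE {n} {m} Z′ ∣) (rankZ Z′ cf′) ⟨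
      r Q (embedE {n} {m} Z′) + ∣ Y ─ embedE {n} {m} Z′ ∣ ≤⟨ le ⟩
      r Q Y                              ∎
      where open ≤-Reasoning
    ... | inj₂ (G , flG , neG , refl) = begin
      suc (r M F)                        ≤⟨ s≤s (r-─ M F G) ⟩
      suc (r M G) + ∣ F ─ G ∣            ≤⟨ +-monoʳ-≤ (suc (r M G)) (∣─qOf∣ G) ⟩
      suc (r M G) + ∣ Y ─ qOf {n} {m} G ∣        ≡⟨ cong (_+ ∣ Y ─ qOf {n} {m} G ∣) (rankq G flG neG) ⟨
      r Q (qOf {n} {m} G) + ∣ Y ─ qOf {n} {m} G ∣        ≤⟨ le ⟩
      r Q Y                              ∎
      where open ≤-Reasoning

-- Gives at once that `q(F) ∩ S` has no coloops and that its rank is `r(F) + 1`. Bounds on `m` enter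
-- here: after losing an element, T_e must still supply one element when E or the tip supplies the
-- rest, hence `m ≥ 2`, and two when both are deleted, hence `m ≥ 3`.
Robust : ∀ n m → Subset (qsize n m) → Set
Robust n m S = ∀ {F} q → Nonempty F → enc {n} {m} q ∈ qOf {n} {m} F ∩ S → Transversal F (qOf {n} {m} F ∩ S - enc q)

module _ {n m : ℕ} {M : Matroid n} {Q : Matroid (qsize n m)} (cone : IsFreeCone M m Q) (i₀ : Fin m)
         {hasE hasA : Bool} {S : Subset (qsize n m)} (ground : IsGround {n} {m} hasE hasA S) (robust : Robust n m S) where

  open IsFreeCone cone

  private
    T∈ : ∀ {F e} i → e ∈ F → enc (eT e i) ∈ qOf {n} {m} F ∩ S
    T∈ {e = e} i e∈F = x∈p∩q⁺ (∈qOf⁺ (eT e i) refl e∈F , ∈ground ground (eT e i) refl)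

  flat∩ : ∀ {X} → IsFlat Q X → IsFlatIn Q S (X ∩ S)
  flat∩ {X} flX = p∩q⊆q X S , λ e e∈S e∉ → r<r∪⁅⁆ Q flX (p∩q⊆p X S) (λ e∈X → e∉ (x∈p∩q⁺ (e∈X , e∈S)))

  r-qOf∩ : ∀ {F} → IsFlat M F → Nonempty F → r Q (qOf {n} {m} F ∩ S) ≡ suc (r M F)
  r-qOf∩ {F} flF neF@(e , e∈F) = ≤-antisym
    (≤-trans (r-mono Q (p∩q⊆p (qOf {n} {m} F) S)) (≤-reflexive (rankq F flF neF)))
    -- What remains after removing an arbitrary element of T already attains the rank required of
    -- the whole trace.
    (≤-trans (transversal-rank cone (robust (eT e i₀) neF (T∈ i₀ e∈F))) (r-mono Q (p─q⊆p _ _)))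

  qOf∩-cyclicFlat : ∀ {F} → IsFlat M F → Nonempty F → IsCyclicFlatIn Q S (qOf {n} {m} F ∩ S)
  qOf∩-cyclicFlat {F} flF neF =
    flat∩ (proj₁ (Equivalence.from (cyclicFlats (qOf {n} {m} F)) (inj₂ (F , flF , neF , refl)))) , cyclic
    where
    cyclic : IsCyclic Q (qOf {n} {m} F ∩ S)
    cyclic j j∈ with q , refl ← enc-surjective {n} {m} j = ≤-antisym (r-mono Q (p─q⊆p _ _))
      (≤-trans (≤-reflexive (r-qOf∩ flF neF)) (transversal-rank cone (robust q neF j∈)))

  private
    ≡cl∩ : ∀ {X} → IsFlatIn Q S X → X ≡ cl Q X ∩ S
    ≡cl∩ {X} (X⊆S , gain) = ⊆-antisym (λ x∈ → x∈p∩q⁺ (⊆cl Q X x∈ , X⊆S x∈)) back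
      where
      back : cl Q X ∩ S ⊆ X
      back {e} e∈ with e∈cl , e∈S ← x∈p∩q⁻ (cl Q X) S e∈ with e ∈? X
      ... | yes e∈X = e∈X
      ... | no  e∉X = contradiction
        (≤-trans (r-mono Q (∪-least (⊆cl Q X) (⁅⁆⊆ e∈cl))) (≤-reflexive (r-cl Q X))) (<⇒≱ (gain e e∈S e∉X))

  cyclicFlatIn-cases : ∀ {X} → IsCyclicFlatIn Q S X →
    (∃ λ Z → IsCyclicFlat M Z × X ≡ embedE {n} {m} Z ∩ S) ⊎ (∃ λ F → IsFlat M F × Nonempty F × X ≡ qOf {n} {m} F ∩ S)
  cyclicFlatIn-cases {X} (flX , cyc) with Equivalence.to (cyclicFlats (cl Q X)) (cl-flat Q X , cl-cyclic Q cyc)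
  ... | inj₁ (Z , cf , eq)        = inj₁ (Z , cf , trans (≡cl∩ flX) (cong (_∩ S) eq))
  ... | inj₂ (F , flF , neF , eq) = inj₂ (F , flF , neF , trans (≡cl∩ flX) (cong (_∩ S) eq))

  qOf∩⊆⁻ : ∀ {F G} → qOf {n} {m} F ∩ S ⊆ qOf {n} {m} G ∩ S → F ⊆ G
  qOf∩⊆⁻ {F} {G} sub {e} e∈F = ∈qOf⁻ (eT e i₀) refl (p∩q⊆p (qOf {n} {m} G) S (sub (T∈ i₀ e∈F)))

  qOf∩⊆⁺ : ∀ {F G} → F ⊆ G → qOf {n} {m} F ∩ S ⊆ qOf {n} {m} G ∩ S
  qOf∩⊆⁺ {F} {G} F⊆G = ⊆-enc go
    where
    go : ∀ q → enc {n} {m} q ∈ qOf {n} {m} F ∩ S → enc {n} {m} q ∈ qOf {n} {m} G ∩ S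
    go q q∈ with q∈F , q∈S ← x∈p∩q⁻ (qOf {n} {m} F) S q∈ = x∈p∩q⁺ (mono q q∈F , q∈S)
      where
      mono : ∀ q → enc {n} {m} q ∈ qOf {n} {m} F → enc {n} {m} q ∈ qOf {n} {m} G
      mono q@(eE e)   q∈F = ∈qOf⁺ q refl (F⊆G (∈qOf⁻ q refl q∈F))
      mono q@(eT e i) q∈F = ∈qOf⁺ q refl (F⊆G (∈qOf⁻ q refl q∈F))
      mono eA         _   = A∈qOf G

module _ {n m′ : ℕ} {hasE hasA : Bool} {S : Subset (qsize n (suc (suc m′)))}
         (ground : IsGround {n} {suc (suc m′)} hasE hasA S) where

  private
    ∈remaining : ∀ {F e} p q → base p ≡ just e → e ∈ F → groundPart hasE hasA p ≡ inside → p ≢ q →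
                 enc {n} {suc (suc m′)} p ∈ qOf {n} {suc (suc m′)} F ∩ S - enc q
    ∈remaining p q bp e∈F p∈S p≢q = x∈p∧x≢y⇒x∈p-y
      (x∈p∩q⁺ (∈qOf⁺ p bp e∈F , ∈ground ground p p∈S)) (p≢q ∘ enc-injective)

    on-qOf : ∀ {F e} q → base q ≡ just e → enc {n} {suc (suc m′)} q ∈ qOf {n} {suc (suc m′)} F ∩ S → e ∈ F
    on-qOf {F} q bq q∈ = ∈qOf⁻ q bq (p∩q⊆p (qOf {n} {suc (suc m′)} F) S q∈)

    on-S : ∀ {F} q → enc {n} {suc (suc m′)} q ∈ qOf {n} {suc (suc m′)} F ∩ S → groundPart hasE hasA q ≢ outside
    on-S {F} q q∈ eq = ∉ground ground q eq (p∩q⊆q (qOf {n} {suc (suc m′)} F) S q∈)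

  -- Removing an element outside every T_e leaves two elements of each T_e.
  transversal-T : ∀ {F} q → Nonempty F → (∀ e i → eT e i ≢ q) → Transversal F (qOf {n} {suc (suc m′)} F ∩ S - enc q)
  transversal-T q (e , e∈F) ≢q = record
    { choice      = λ e → eT e 0F
    ; choice-base = λ _ → refl
    ; choice∈     = λ {e} e∈F → ∈remaining (eT e 0F) q refl e∈F refl (≢q e 0F)
    ; extra       = eT e 1F
    ; extra∈      = ∈remaining (eT e 1F) q refl e∈F refl (≢q e 1F)
    ; extra∉E     = λ _ ()
    ; extra≢      = λ _ ()
    }

  -- When an element of some T_e is removed, E itself is the choice and `punchIn i 0F` names a
  -- surviving element of the same T_e.
  robust-E : hasE ≡ true → hasA ≡ false → Robust n (suc (suc m′)) S
  robust-E refl refl {F} eA     neF q∈ = contradiction refl (on-S {F} eA q∈)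
  robust-E refl refl q@(eE _)   neF q∈ = transversal-T q neF (λ _ _ ())
  robust-E refl refl q@(eT e i) neF q∈ = record
    { choice      = eE
    ; choice-base = λ _ → refl
    ; choice∈     = λ {e} e∈F → ∈remaining (eE e) q refl e∈F refl (λ ())
    ; extra       = eT e (punchIn i 0F)
    ; extra∈      = ∈remaining (eT e (punchIn i 0F)) q refl (on-qOf q refl q∈) refl (punchInᵢ≢i i 0F ∘ eT-injectiveʳ)
    ; extra∉E     = λ _ ()
    ; extra≢      = λ _ ()
    }

  -- When an element with index `i` is removed, the choice avoids the index `i` over every `e`, and
  -- the tip is the extra element.
  robust-A : hasE ≡ false → hasA ≡ true → Robust n (suc (suc m′)) S
  robust-A refl refl q@(eE e)   neF q∈ = contradiction refl (on-S q q∈)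
  robust-A refl refl eA         neF q∈ = transversal-T eA neF (λ _ _ ())
  robust-A refl refl {F} q@(eT _ i) neF q∈ = record
    { choice      = λ e → eT e (punchIn i 0F)
    ; choice-base = λ _ → refl
    ; choice∈     = λ {e} e∈F → ∈remaining (eT e (punchIn i 0F)) q refl e∈F refl (punchInᵢ≢i i 0F ∘ eT-injectiveʳ)
    ; extra       = eA
    ; extra∈      = x∈p∧x≢y⇒x∈p-y (x∈p∩q⁺ (A∈qOf F , ∈ground ground eA refl)) (A≢T ∘ enc-injective)
    ; extra∉E     = λ _ ()
    ; extra≢      = λ _ ()
    }
    where
    A≢T : ∀ {e} {i} → _≢_ {A = QElem n (suc (suc m′))} eA (eT e i)
    A≢T ()

module _ {n m′ : ℕ} {S : Subset (qsize n (suc (suc (suc m′))))}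
         (ground : IsGround {n} {suc (suc (suc m′))} false false S) where

  -- Choice and extra element both come from T: `punchIn i` sends 0 and 1 to two distinct indices
  -- other than `i`.
  robust-T : Robust n (suc (suc (suc m′))) S
  robust-T q@(eE _) neF q∈ = contradiction (p∩q⊆q (qOf {n} {suc (suc (suc m′))} _) S q∈) (∉ground ground q refl)
  robust-T eA       neF q∈ = contradiction (p∩q⊆q (qOf {n} {suc (suc (suc m′))} _) S q∈) (∉ground ground eA refl)
  robust-T {F} q@(eT e i) neF q∈ = record
    { choice      = λ e → eT e (punchIn i 0F)
    ; choice-base = λ _ → refl
    ; choice∈     = λ e∈F → remaining _ 0F e∈F
    ; extra       = eT e (punchIn i 1F)
    ; extra∈      = remaining e 1F (∈qOf⁻ q refl (p∩q⊆p (qOf {n} {suc (suc (suc m′))} F) S q∈))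
    ; extra∉E     = λ _ ()
    ; extra≢      = λ _ eq → 0≢1+nᶠ (sym (punchIn-injective i 1F 0F (eT-injectiveʳ eq)))
    }
    where
    remaining : ∀ d l → d ∈ F → enc (eT d (punchIn i l)) ∈ qOf {n} {suc (suc (suc m′))} F ∩ S - enc q
    remaining d l d∈F = x∈p∧x≢y⇒x∈p-y
      (x∈p∩q⁺ (∈qOf⁺ (eT d (punchIn i l)) refl d∈F , ∈ground ground (eT d (punchIn i l)) refl))
      (punchInᵢ≢i i l ∘ eT-injectiveʳ {n} ∘ enc-injective)

-- From configurations to correspondences

-- `s` and `t` convert sizes and ranks in `A` into those in the restriction of `Q`; their
-- injectivity later lets the original values be recovered.
record Presents (s t : ℕ → ℕ) (A : SizedPoset) (Q : Matroid n) (S : Subset n) : Set where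
  field
    val        : Carrier A → CF Q S
    val-mono   : ∀ {a b} → _⊑_ A a b → proj₁ (val a) ⊆ proj₁ (val b)
    val-cancel : ∀ {a b} → proj₁ (val a) ⊆ proj₁ (val b) → _⊑_ A a b
    val-size   : ∀ a → ∣ proj₁ (val a) ∣ ≡ s (size A a)
    val-rank   : ∀ a → r Q (proj₁ (val a)) ≡ t (rank A a)
    surjective : ∀ (X : CF Q S) → ∃ λ a → proj₁ X ≡ proj₁ (val a)

module _ {s t : ℕ → ℕ} (s-injective : ∀ {x y} → s x ≡ s y → x ≡ y) (t-injective : ∀ {x y} → t x ≡ t y → x ≡ y)
         {A B : SizedPoset}
         {Q : Matroid n} {S : Subset n} {P : Matroid k} {T : Subset k}
         (presA : Presents s t A Q S) (presB : Presents s t B P T) (config : ConfigEq Q S P T) where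

  private
    module A = Presents presA
    module B = Presents presB
    module C = ConfigEq config

    -- A priori `f` may depend on the proof attached to a set; preservation of inclusions both ways
    -- rules this out.
    f-cong : ∀ {X Y} → proj₁ X ≡ proj₁ Y → proj₁ (C.f X) ≡ proj₁ (C.f Y)
    f-cong {X} {Y} eq = ⊆-antisym
      (Equivalence.to (C.order X Y) (⊆-reflexive eq))
      (Equivalence.to (C.order Y X) (⊆-reflexive (sym eq)))

  configEq⇒correspondence : Correspondence A B
  configEq⇒correspondence = record
    { _~_     = λ a b → proj₁ (C.f (A.val a)) ≡ proj₁ (B.val b)
    ; total   = λ a → B.surjective (C.f (A.val a))
    ; cototal = λ b → let a , eq = A.surjective (C.g (B.val b)) in a , trans (f-cong (sym eq)) (C.f∘g (B.val b))
    ; mono    = λ {a} {b} {a′} {b′} p q a⊑a′ → B.val-cancel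
        (⊆-trans (⊆-reflexive (sym p))
          (⊆-trans (Equivalence.to (C.order (A.val a) (A.val a′)) (A.val-mono a⊑a′)) (⊆-reflexive q)))
    ; reflect = λ {a} {b} {a′} {b′} p q b⊑b′ → A.val-cancel
        (Equivalence.from (C.order (A.val a) (A.val a′))
          (⊆-trans (⊆-reflexive p) (⊆-trans (B.val-mono b⊑b′) (⊆-reflexive (sym q)))))
    ; ~-size  = λ {a} {b} p → s-injective
        (trans (sym (A.val-size a)) (trans (sym (C.size (A.val a))) (trans (cong ∣_∣ p) (B.val-size b))))
    ; ~-rank  = λ {a} {b} p → t-injective
        (trans (sym (A.val-rank a)) (trans (sym (C.rank (A.val a))) (trans (cong (r P) p) (B.val-rank b))))
    }

-- The cone without its tip, presented by codes

module _ {n m : ℕ} {M : Matroid n} {Q : Matroid (qsize n m)} (cone : IsFreeCone M m Q) (i₀ : Fin m)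
         {S : Subset (qsize n m)} (ground : IsGround {n} {m} true false S) (robust : Robust n m S) where

  open IsFreeCone cone

  private
    embedE⊆S : ∀ {Z} → embedE {n} {m} Z ⊆ S
    embedE⊆S {Z} = ⊆-enc {n} {m} λ q q∈ →
      let e , eq , _ = ∈embedE⁻ q q∈ in subst (λ p → enc {n} {m} p ∈ S) (sym eq) (∈ground ground (eE e) refl)

    embedE∩S : ∀ Z → embedE {n} {m} Z ∩ S ≡ embedE {n} {m} Z
    embedE∩S Z = ⊆-antisym (p∩q⊆p _ S) (λ x∈ → x∈p∩q⁺ (x∈ , embedE⊆S {Z} x∈))

    val : Code M → CF Q S
    val (zz Z cf) with flZ , cyc ← Equivalence.from (cyclicFlats (embedE {n} {m} Z)) (inj₁ (Z , cf , refl)) =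
      embedE {n} {m} Z , (embedE⊆S {Z} , λ e _ → proj₂ flZ e ∈⊤) , cyc
    val (qq F flF neF) = qOf {n} {m} F ∩ S , qOf∩-cyclicFlat cone i₀ ground robust flF neF

    val-mono : ∀ {a b} → _⊑_ (Codes m M) a b → proj₁ (val a) ⊆ proj₁ (val b)
    val-mono {zz Z _} {zz Z′ _} Z⊆Z′ = ⊆-enc {n} {m} λ q q∈ →
      let e , eq , e∈Z = ∈embedE⁻ q q∈ in
      subst (λ p → enc {n} {m} p ∈ embedE {n} {m} Z′) (sym eq) (∈embedE⁺ {Z = Z′} (Z⊆Z′ e∈Z))
    val-mono {zz Z _} {qq F _ _} Z⊆F = ⊆-enc {n} {m} λ q q∈ →
      let e , eq , e∈Z = ∈embedE⁻ q q∈ in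
      subst (λ p → enc {n} {m} p ∈ qOf {n} {m} F ∩ S) (sym eq)
        (x∈p∩q⁺ (∈qOf⁺ (eE e) refl (Z⊆F e∈Z) , ∈ground ground (eE e) refl))
    val-mono {qq F _ _} {qq G _ _} F⊆G = qOf∩⊆⁺ cone i₀ ground robust F⊆G

    val-cancel : ∀ {a b} → proj₁ (val a) ⊆ proj₁ (val b) → _⊑_ (Codes m M) a b
    val-cancel {zz Z _} {zz Z′ _} sub {e} e∈Z
      with _ , refl , e∈Z′ ← ∈embedE⁻ {Z = Z′} (eE e) (sub (∈embedE⁺ {Z = Z} e∈Z)) = e∈Z′
    val-cancel {zz Z _} {qq F _ _} sub {e} e∈Z =
      ∈qOf⁻ (eE e) refl (p∩q⊆p (qOf {n} {m} F) S (sub (∈embedE⁺ {Z = Z} e∈Z)))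
    val-cancel {qq F _ (e , e∈F)} {zz Z _} sub
      with _ , () , _ ← ∈embedE⁻ {Z = Z} (eT e i₀)
                          (sub (x∈p∩q⁺ (∈qOf⁺ (eT e i₀) refl e∈F , ∈ground ground (eT e i₀) refl)))
    val-cancel {qq F _ _} {qq G _ _} sub = qOf∩⊆⁻ cone i₀ ground robust sub

    val-size : ∀ a → ∣ proj₁ (val a) ∣ ≡ size (Codes m M) a
    val-size (zz Z _) = ∣embedE∣ Z
    val-size (qq F _ _) = trans (∣qOf∩∣ ground F)
      (cong₂ _+_ (+-identityʳ ∣ F ∣) (trans (+-identityʳ _) (*-comm ∣ F ∣ m)))

    val-rank : ∀ a → r Q (proj₁ (val a)) ≡ rank (Codes m M) a
    val-rank (zz Z cf)      = rankZ Z cf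
    val-rank (qq F flF neF) = r-qOf∩ cone i₀ ground robust flF neF

    surjective : ∀ (X : CF Q S) → ∃ λ a → proj₁ X ≡ proj₁ (val a)
    surjective (X , cf) with cyclicFlatIn-cases cone i₀ ground robust cf
    ... | inj₁ (Z , cf , eq)        = zz Z cf , trans eq (embedE∩S Z)
    ... | inj₂ (F , flF , neF , eq) = qq F flF neF , eq

  codes-present : Presents (λ x → x) (λ x → x) (Codes m M) Q S
  codes-present = record
    { val = val ; val-mono = val-mono ; val-cancel = val-cancel
    ; val-size = val-size ; val-rank = val-rank ; surjective = surjective }

-- |q(F) ∩ S| as a function of |F|, for S disjoint from E; the empty flat is represented by ∅.
coneSize : ℕ → Bool → ℕ → ℕ
coneSize m hasA zero    = 0
coneSize m hasA (suc x) = suc x * m + ∣ hasA ∷ [] ∣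

coneSize-injective : ∀ m hasA {x y} → coneSize (suc m) hasA x ≡ coneSize (suc m) hasA y → x ≡ y
coneSize-injective m hasA {zero}  {zero}  eq = refl
coneSize-injective m hasA {suc x} {suc y} eq = *-cancelʳ-≡ (suc x) (suc y) (suc m) (+-cancelʳ-≡ ∣ hasA ∷ [] ∣ _ _ eq)

-- Coning raises the rank by one except at the empty flat, the only flat of rank 0 in a loopless
-- matroid.
coneRank : ℕ → ℕ
coneRank zero    = 0
coneRank (suc x) = suc (suc x)

coneRank-injective : ∀ {x y} → coneRank x ≡ coneRank y → x ≡ y
coneRank-injective {zero}  {zero}  eq = refl
coneRank-injective {suc x} {suc y} eq = suc-injective eq

-- The cone without E, with or without its tip, presented by the flats of `M`

module _ {n m : ℕ} {M : Matroid n} {Q : Matroid (qsize n m)} (loopless : Loopless M)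
         (cone : IsFreeCone M m Q) (i₀ : Fin m)
         {hasA : Bool} {S : Subset (qsize n m)} (ground : IsGround {n} {m} false hasA S) (robust : Robust n m S) where

  open IsFreeCone cone

  private
    embedE∩S-empty : ∀ Z → Empty (embedE {n} {m} Z ∩ S)
    embedE∩S-empty Z (j , j∈) with q , refl ← enc-surjective {n} {m} j
      with j∈Z , j∈S ← x∈p∩q⁻ (embedE {n} {m} Z) S j∈
      with e , refl , _ ← ∈embedE⁻ {Z = Z} q j∈Z = ∉ground ground (eE e) refl j∈S

    Empty⇒cyclicFlat : ∀ {F} → IsFlat M F → Empty F → IsCyclicFlat M F
    Empty⇒cyclicFlat flF eF = flF , λ e e∈F → contradiction (e , e∈F) eF

    embedE∩S-flat : ∀ {F} → IsFlat M F → Empty F → IsCyclicFlatIn Q S (embedE {n} {m} F ∩ S)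
    embedE∩S-flat {F} flF eF =
      flat∩ cone i₀ ground robust
        (proj₁ (Equivalence.from (cyclicFlats (embedE {n} {m} F)) (inj₁ (F , Empty⇒cyclicFlat flF eF , refl)))) ,
      λ e e∈ → contradiction (e , e∈) (embedE∩S-empty F)

    -- The empty flat has no cone, so its value is the empty trace of a cyclic flat of `M`. The
    -- decision is an argument so that `valᵈ-yes` and `valᵈ-no` can treat every decision at once.
    valᵈ : (F : Carrier (Flats M)) → Dec (Nonempty (proj₁ F)) → CF Q S
    valᵈ (F , flF) (yes neF) = qOf {n} {m} F ∩ S , qOf∩-cyclicFlat cone i₀ ground robust flF neF
    valᵈ (F , flF) (no  eF)  = embedE {n} {m} F ∩ S , embedE∩S-flat flF eF

    val : Carrier (Flats M) → CF Q S
    val F = valᵈ F (nonempty? (proj₁ F))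

    val-mono : ∀ {F G} → proj₁ F ⊆ proj₁ G → proj₁ (val F) ⊆ proj₁ (val G)
    val-mono {F , _} {G , _} F⊆G with nonempty? F | nonempty? G
    ... | no  _         | _      = λ x∈ → contradiction (_ , x∈) (embedE∩S-empty F)
    ... | yes (e , e∈F) | no eG  = contradiction (e , F⊆G e∈F) eG
    ... | yes _         | yes _  = qOf∩⊆⁺ cone i₀ ground robust F⊆G

    val-cancel : ∀ {F G} → proj₁ (val F) ⊆ proj₁ (val G) → proj₁ F ⊆ proj₁ G
    val-cancel {F , _} {G , _} sub with nonempty? F | nonempty? G
    ... | no  eF        | _      = λ x∈ → contradiction (_ , x∈) eF
    ... | yes (e , e∈F) | no _   = contradiction
      (_ , sub (x∈p∩q⁺ (∈qOf⁺ (eT e i₀) refl e∈F , ∈ground ground (eT e i₀) refl))) (embedE∩S-empty G)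
    ... | yes _         | yes _  = qOf∩⊆⁻ cone i₀ ground robust sub

    coneSize-pos : ∀ {x} → 0 < x → x * m + ∣ hasA ∷ [] ∣ ≡ coneSize m hasA x
    coneSize-pos {suc _} _ = refl

    val-size : ∀ F → ∣ proj₁ (val F) ∣ ≡ coneSize m hasA ∣ proj₁ F ∣
    val-size (F , _) with nonempty? F
    ... | yes neF = trans (∣qOf∩∣ ground F) (coneSize-pos (Nonempty⇒0< neF))
    ... | no  eF  = trans (∣Empty∣ (embedE∩S-empty F)) (cong (coneSize m hasA) (sym (∣Empty∣ eF)))

    coneRank-pos : ∀ {x} → 0 < x → suc x ≡ coneRank x
    coneRank-pos {suc _} _ = refl

    val-rank : ∀ F → r Q (proj₁ (val F)) ≡ coneRank (r M (proj₁ F))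
    val-rank (F , flF) with nonempty? F
    ... | yes neF = trans (r-qOf∩ cone i₀ ground robust flF neF) (coneRank-pos (loopless⇒0<r M loopless neF))
    ... | no  eF  = trans (r-⊥ Q (embedE∩S-empty F)) (cong coneRank (sym (r-⊥ M eF)))

    valᵈ-yes : ∀ {F flF} → Nonempty F → ∀ d → qOf {n} {m} F ∩ S ≡ proj₁ (valᵈ (F , flF) d)
    valᵈ-yes neF (yes _) = refl
    valᵈ-yes neF (no eF) = contradiction neF eF

    valᵈ-no : ∀ {F flF} → Empty F → ∀ d → Empty (proj₁ (valᵈ (F , flF) d))
    valᵈ-no     eF (yes neF) = contradiction neF eF
    valᵈ-no {F} eF (no _)    = embedE∩S-empty F

    surjective : ∀ (X : CF Q S) → ∃ λ F → proj₁ X ≡ proj₁ (val F)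
    surjective (X , cf) with cyclicFlatIn-cases cone i₀ ground robust cf
    -- As `S` avoids E, all cyclic flats of `M` have the same empty trace, represented by `⊥`, which
    -- is a flat by looplessness.
    ... | inj₁ (Z , _ , eq) = (⊥ , ⊥-flat M loopless) ,
      trans eq (trans (Empty-unique (embedE∩S-empty Z))
        (sym (Empty-unique (valᵈ-no {flF = ⊥-flat M loopless} (∉⊥ ∘ proj₂) (nonempty? ⊥)))))
    ... | inj₂ (F , flF , neF , eq) = (F , flF) , trans eq (valᵈ-yes {flF = flF} neF (nonempty? F))

  flats-present : Presents (coneSize m hasA) coneRank (Flats M) Q S
  flats-present = record
    { val = val ; val-mono = λ {F} {G} → val-mono {F} {G} ; val-cancel = λ {F} {G} → val-cancel {F} {G}
    ; val-size = val-size ; val-rank = val-rank ; surjective = surjective }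

theorem4p4 : (∀ (m : ℕ) → 1 < m → ∀ {n k} (M : Matroid n) (N : Matroid k) →
    Loopless M → Loopless N →
    (Q : Matroid (qsize n m)) (P : Matroid (qsize k m)) →
    IsFreeCone M m Q → IsFreeCone N m P →
    ConfigEq Q (groundMinusA n m) P (groundMinusA k m) → Iso M N)
    × (∀ (m : ℕ) → 1 < m → ∀ {n k} (M : Matroid n) (N : Matroid k) →
    Loopless M → Loopless N →
    (Q : Matroid (qsize n m)) (P : Matroid (qsize k m)) →
    IsFreeCone M m Q → IsFreeCone N m P →
    ConfigEq Q (groundMinusE n m) P (groundMinusE k m) → Iso M N)
    × (∀ (m : ℕ) → 2 < m → ∀ {n k} (M : Matroid n) (N : Matroid k) →
    Loopless M → Loopless N →
    (Q : Matroid (qsize n m)) (P : Matroid (qsize k m)) →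
    IsFreeCone M m Q → IsFreeCone N m P →
    ConfigEq Q (groundT n m) P (groundT k m) → Iso M N)
theorem4p4 = minusA , minusE , onlyT
  where
  minusA : _
  minusA (suc (suc m)) 1<m@(s≤s (s≤s _)) M N llM llN Q P coneQ coneP config =
    flats-correspond⇒Iso llM llN (codes-correspond⇒flats-correspond 1<m llM llN
      (configEq⇒correspondence (λ eq → eq) (λ eq → eq) (present coneQ) (present coneP) config))
    where
    present : ∀ {n} {M : Matroid n} {Q} → IsFreeCone M (suc (suc m)) Q →
              Presents _ _ (Codes (suc (suc m)) M) Q (groundMinusA n (suc (suc m)))
    present cone = codes-present cone 0F groundMinusA-isGround (robust-E groundMinusA-isGround refl refl)

  minusE : _
  minusE (suc (suc m)) (s≤s (s≤s _)) M N llM llN Q P coneQ coneP config =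
    flats-correspond⇒Iso llM llN
      (configEq⇒correspondence (coneSize-injective (suc m) true) coneRank-injective
        (present llM coneQ) (present llN coneP) config)
    where
    present : ∀ {n} {M : Matroid n} {Q} → Loopless M → IsFreeCone M (suc (suc m)) Q →
              Presents _ _ (Flats M) Q (groundMinusE n (suc (suc m)))
    present ll cone = flats-present ll cone 0F groundMinusE-isGround (robust-A groundMinusE-isGround refl refl)

  onlyT : _
  onlyT (suc (suc (suc m))) (s≤s (s≤s (s≤s _))) M N llM llN Q P coneQ coneP config =
    flats-correspond⇒Iso llM llN
      (configEq⇒correspondence (coneSize-injective (suc (suc m)) false) coneRank-injective
        (present llM coneQ) (present llN coneP) config)
    where
    present : ∀ {n} {M : Matroid n} {Q} → Loopless M → IsFreeCone M (suc (suc (suc m))) Q →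
              Presents _ _ (Flats M) Q (groundT n (suc (suc (suc m))))
    present ll cone = flats-present ll cone 0F groundT-isGround (robust-T groundT-isGround)
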